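{- Let $G=(V,E)$ be a simple, connected, undirected graph, let $z$ be the optimal value of the minimum branch vertices problem on $G$ (the minimum number of branch vertices over all spanning trees of $G$), let $L_o$ be the set of obligatory branches of $G$, and let $G'_o$ be the graph obtained from $G$ by performing the obligatory branches based decomposition and the cut edges based decomposition. Let $K$ be the number of connected components of $G'_o$, and for each $k\in\{1,\dots,K\}$ let $z_k$ be the optimal value of the integer program associated with the $k$-th connected component (all these objects are defined in the context). Then an optimal solution to the minimum branch vertices problem on $G$ can be obtained from the solutions of the $K$ connected components of $G'_o$ (that is, of their associated integer programs), and its optimal value is $$z=|L_o|+\sum_{k=1}^K z_k .$$
   Context: Branch vertices and the problem. For a graph $H$, $d_H(v)$ denotes the degree of $v$ in $H$. A vertex $v$ is a branch vertex of a spanning tree $T$ if $d_T(v)>2$. The minimum branch vertices problem on $G$ asks for a spanning tree of $G$ with the minimum number of branch vertices. Obligatory branches. For $v\in V$, $G-v$ is the graph obtained by deleting $v$ and all its incident edges, and $\alpha(v)$ is the number of connected components of $G-v$. A vertex $v$ is an obligatory branch of $G$ if $\alpha(v)\ge 3$; $L_o$ is the set of obligatory branches. Obligatory branches based decomposition. Starting from $G$, each $v\in L_o$ is replaced by $\alpha(v)$ new vertices $v_1,\dots,v_{\alpha(v)}$, one for each connected component of $G-v$. For each $i$, $v_i$ is joined to the neighbours of $v$ lying in the $i$-th connected component of $G-v$, and $v$ with its incident edges is deleted. This is done for all $v\in L_o$. Thus an edge $(u,v)\in E$ becomes the edge between $u$ (or, if $u\in L_o$, the copy of $u$ associated with the component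 of $G-u$ containing $v$) and $v$ (or, if $v\in L_o$, the copy of $v$ associated with the component of $G-v$ containing $u$). The resulting graph is $G_o$. The new vertices $v_i$ are called artificially created. Cut edges based decomposition. A cut edge is an edge whose removal increases the number of connected components, and $B$ is the set of cut edges of $G$. All edges in $B$ (or the edges corresponding to them) are removed. For a vertex $v$, the extra degree $\gamma(v)$ is the number of cut edges in $B$ incident to $v$ in $G$. $G'_o=(V'_o,E'_o)$ is the graph obtained after performing both decompositions. Its connected components are ${G'}_o^k=({V'}_o^k,{E'}_o^k)$, $k=1,\dots,K$. Let ${\overline{V}'}_o^k$ be the set of vertices of ${V'}_o^k$ that are not artificially created. Component integer program. For each $k$, with a variable $x_{uv}$ for each edge $(u,v)\in {E'}_o^k$ and a variable $y_v$ for each vertex $v\in {V'}_o^k$, $z_k$ is the optimal value of $$z_k=\min \sum_{v\in {\overline{V}'}_o^k} y_v$$ subject to $$\sum_{(u,v)\in {E'}_o^k}x_{uv}=|{V'}_o^k|-1,$$ $$\sum_{(u,v)\in {E'}_o^k:\,u,v\in S}x_{uv}\le |S|-1\quad\text{for all nonempty } S\subset {V'}_o^k,$$ $$\sum_{u:(u,v)\in {E'}_o^k}x_{uv}+\gamma(v)\le 2+(d_G(v)-2)\,y_v\quad\text{for all } v\in {\overline{V}'}_o^k,$$ $$x\in\{0,1\}^{|{E'}_o^k|},\qquad y\in\{0,1\}^{|{V'}_o^k|}.$$ -}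

module Defs where

open import Level using (Level; 0ℓ) renaming (suc to lsuc)
open import Data.Bool.Base using (Bool; true; T)
open import Data.Bool.Properties using (T?)
open import Data.Empty using (⊥; ⊥-elim-irr)
open import Data.Unit.Base using (⊤)
open import Data.Fin.Base using (Fin; zero; suc; toℕ; punchIn; punchOut)
import Data.Fin.Properties as Fin
open import Data.Integer.Base as ℤ using (+_)
open import Data.Irrelevant using ([_])
open import Data.List.Base
  using (List; []; _∷_; _++_; _∷ʳ_; map; concatMap; filter; length; allFin; lookup; cartesianProduct)
open import Data.List.Membership.Propositional using (_∈_; lose; find)
open import Data.List.Membership.Propositional.Properties
  using (∈-map⁺; ∈-map⁻; ∈-allFin; ∈-concat⁺′; ∈-lookup; ∈-cartesianProduct⁺; ∈-filter⁺; ∈-filter⁻)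
open import Data.List.Relation.Unary.All as All using (All; []; _∷_)
import Data.List.Relation.Unary.All.Properties as All
open import Data.List.Relation.Unary.AllPairs as AllPairs using ([]; _∷_)
import Data.List.Relation.Unary.AllPairs.Properties as AllPairs
open import Data.List.Relation.Unary.Any as Any using (here; there; any?)
open import Data.List.Relation.Unary.Any.Properties using (lookup-index)
open import Data.List.Relation.Unary.Linked using (Linked)
open import Data.List.Relation.Unary.Unique.Propositional using (Unique)
import Data.List.Relation.Unary.Unique.Propositional.Properties as Unique
open import Data.Nat.Base using (ℕ; zero; suc; _+_; _∸_; _≤_; _<_)
open import Data.Nat.ListAction using (sum)
open import Data.Nat.Properties using (_≤?_; _<?_; ≤-antisym)
open import Data.Product.Base using (Σ; ∃; _×_; _,_; proj₁; proj₂)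
open import Data.Refinement using (Refinement; Refinement-syntax; value; _,_)
import Data.Refinement.Properties as Refinement
open import Data.Sum.Base as Sum using (_⊎_; inj₁; inj₂; [_,_]′)
open import Function.Base using (_∘_)
open import Relation.Binary.Construct.Closure.Equivalence as Eq using (EqClosure)
open import Relation.Binary.Construct.Closure.ReflexiveTransitive as Star using (Star; ε; _◅_)
open import Relation.Binary.Construct.Closure.Symmetric using (fwd; bwd)
open import Relation.Binary.Core using (Rel)
open import Relation.Binary.Structures using (IsEquivalence)
open import Relation.Binary.Definitions using (DecidableEquality; Symmetric) renaming (Decidable to Decidable₂)
open import Relation.Binary.PropositionalEquality
  using (_≡_; _≢_; refl; sym; trans; cong; subst; isEquivalence)
open import Relation.Nullary using (Dec; yes; no; ¬_; contradiction)
open import Relation.Nullary.Decidable using (map′; _×-dec_; _⊎-dec_; ¬?)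
open import Relation.Unary using (Pred; Decidable)

private
  variable
    A : Set

record FiniteSet : Set₁ where
  field
    Carrier  : Set
    _≟_      : DecidableEquality Carrier
    elements : List Carrier
    complete : ∀ v → v ∈ elements
    unique   : Unique elements

open FiniteSet using (Carrier; elements)

∣_∣ : FiniteSet → ℕ
∣ V ∣ = length (elements V)

count : (V : FiniteSet) {P : Pred (Carrier V) 0ℓ} → Decidable P → ℕ
count V P? = length (filter P? (elements V))

∑ : List A → (A → ℕ) → ℕ
∑ xs f = sum (map f xs)

-- Every unordered pair of distinct positions of the list, listed once.
pairs : List A → List (A × A)
pairs []       = []
pairs (x ∷ xs) = map (x ,_) xs ++ pairs xs

∃? : (V : FiniteSet) {P : Pred (Carrier V) 0ℓ} → Decidable P → Dec (∃ P)
∃? V P? = map′ (λ p → let v , _ , Pv = find p in v , Pv)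
               (λ (v , Pv) → lose (FiniteSet.complete V v) Pv)
               (any? P? (elements V))

module _ {P : Pred A 0ℓ} (P? : Decidable P) where

  select : List A → List [ v ∈ A ∣ P v ]
  select []       = []
  select (v ∷ vs) with P? v
  ... | yes p = (v , [ p ]) ∷ select vs
  ... | no  _ = select vs

  ∈-select⁺ : ∀ {vs} (v : [ v ∈ A ∣ P v ]) → value v ∈ vs → v ∈ select vs
  ∈-select⁺ {w ∷ vs} v w∈ with P? w
  ∈-select⁺ {w ∷ vs} v         (here refl) | yes _ = here refl
  ∈-select⁺ {w ∷ vs} v         (there w∈)  | yes _ = there (∈-select⁺ v w∈)
  ∈-select⁺ {w ∷ vs} (v , [ p ]) (here refl) | no ¬p = ⊥-elim-irr (¬p p)
  ∈-select⁺ {w ∷ vs} v         (there w∈)  | no  _ = ∈-select⁺ v w∈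

  All-select : ∀ {Q : Pred A 0ℓ} {vs} → All Q vs → All (Q ∘ value) (select vs)
  All-select []                  = []
  All-select {vs = v ∷ _} (q ∷ qs) with P? v
  ... | yes _ = q ∷ All-select qs
  ... | no  _ = All-select qs

  Unique-select : ∀ {vs} → Unique vs → Unique (select vs)
  Unique-select []                  = []
  Unique-select {v ∷ _} (v∉ ∷ vs!) with P? v
  ... | yes _ = All.map (λ v≢w → v≢w ∘ cong value) (All-select v∉) ∷ Unique-select vs!
  ... | no  _ = Unique-select vs!

subset : (V : FiniteSet) {P : Pred (Carrier V) 0ℓ} → Decidable P → FiniteSet
subset V {P} P? = record
  { Carrier  = [ v ∈ Carrier V ∣ P v ]
  ; _≟_      = Refinement._≟_ (FiniteSet._≟_ V)
  ; elements = select P? (elements V)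
  ; complete = λ v → ∈-select⁺ P? v (FiniteSet.complete V (value v))
  ; unique   = Unique-select P? (FiniteSet.unique V)
  }

record Classes {A : Set} (R : Rel A 0ℓ) : Set where
  field
    number     : ℕ
    class      : A → Fin number
    surjective : ∀ k → ∃ λ v → class v ≡ k
    sound      : ∀ {u v} → class u ≡ class v → R u v
    complete   : ∀ {u v} → R u v → class u ≡ class v

module _ {n : ℕ} (i j : Fin n) where

  redirect : Fin n → Fin n
  redirect k with j Fin.≟ k
  ... | yes _ = i
  ... | no  _ = k

  redirect-source : redirect j ≡ i
  redirect-source with j Fin.≟ j
  ... | yes _   = refl
  ... | no  j≢j = contradiction refl j≢j

  redirect-other : ∀ {k} → j ≢ k → redirect k ≡ k
  redirect-other {k} j≢k with j Fin.≟ k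
  ... | yes j≡k = contradiction j≡k j≢k
  ... | no  _   = refl

  redirect-avoids : j ≢ i → ∀ k → j ≢ redirect k
  redirect-avoids j≢i k with j Fin.≟ k
  ... | yes _   = j≢i
  ... | no  j≢k = j≢k

module _ {A : Set} where

  Joined : List (A × A) → Rel A 0ℓ
  Joined es u v = (u , v) ∈ es

  addJoin : ∀ a b es → Classes (EqClosure (Joined es)) → Classes (EqClosure (Joined ((a , b) ∷ es)))
  addJoin a b es C = go number class surjective sound complete (class b Fin.≟ class a)
    where
    open Classes C
    a~b : EqClosure (Joined ((a , b) ∷ es)) a b
    a~b = fwd (here refl) ◅ ε
    go : ∀ n (c : A → Fin n) → (∀ k → ∃ λ v → c v ≡ k) →
         (∀ {u v} → c u ≡ c v → EqClosure (Joined es) u v) →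
         (∀ {u v} → EqClosure (Joined es) u v → c u ≡ c v) →
         Dec (c b ≡ c a) → Classes (EqClosure (Joined ((a , b) ∷ es)))
    go n c surj snd cmp (yes cb≡ca) = record
      { number = n ; class = c ; surjective = surj
      ; sound    = λ eq → Eq.map there (snd eq)
      ; complete = Eq.gfold isEquivalence c λ where
          (here refl) → sym cb≡ca
          (there uv∈) → cmp (fwd uv∈ ◅ ε)
      }
    go zero c surj snd cmp (no cb≢ca) with () ← c a
    go (suc n) c surj snd cmp (no cb≢ca) = record
      { number     = n
      ; class      = c′
      ; surjective = λ k →
          let v , cv≡ = surj (punchIn (c b) k)
              cb≢cv   = λ cb≡cv → Fin.punchInᵢ≢i (c b) k (sym (trans cb≡cv cv≡))
          in v , trans (Fin.punchOut-cong (c b) {i≢k = Fin.punchInᵢ≢i (c b) k ∘ sym}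
                          (trans (redirect-other (c a) (c b) cb≢cv) cv≡))
                       (Fin.punchOut-punchIn (c b))
      ; sound      = λ {u} {v} eq →
          let u′ , u~u′ , cu′ = representative u
              v′ , v~v′ , cv′ = representative v
              eq′ = Fin.punchOut-injective (avoids u) (avoids v) eq
          in Eq.transitive _ u~u′ (Eq.transitive _
               (Eq.map there (snd (trans cu′ (trans eq′ (sym cv′)))))
               (Eq.symmetric _ v~v′))
      ; complete   = Eq.gfold isEquivalence c′ λ where
          (here refl) → Fin.punchOut-cong (c b) (trans (redirect-other (c a) (c b) cb≢ca) (sym (redirect-source (c a) (c b))))
          (there uv∈) → Fin.punchOut-cong (c b) (cong (redirect (c a) (c b)) (cmp (fwd uv∈ ◅ ε)))
      }
      where
      avoids : ∀ v → c b ≢ redirect (c a) (c b) (c v)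
      avoids v = redirect-avoids (c a) (c b) cb≢ca (c v)
      c′ : A → Fin n
      c′ v = punchOut (avoids v)
      representative : ∀ v → ∃ λ v′ → EqClosure (Joined ((a , b) ∷ es)) v v′ ×
                                      c v′ ≡ redirect (c a) (c b) (c v)
      representative v with c b Fin.≟ c v
      ... | yes cb≡cv = a , Eq.transitive _ (Eq.map there (snd (sym cb≡cv))) (Eq.symmetric _ a~b) , refl
      ... | no  _     = v , ε , refl

  lookup-unique : ∀ {xs : List A} → Unique xs → ∀ {i j} → lookup xs i ≡ lookup xs j → i ≡ j
  lookup-unique (x∉ ∷ xs!) {zero}  {zero}  eq = refl
  lookup-unique (x∉ ∷ xs!) {zero}  {suc j} eq = contradiction eq (All.lookup x∉ (∈-lookup j))
  lookup-unique (x∉ ∷ xs!) {suc i} {zero}  eq = contradiction (sym eq) (All.lookup x∉ (∈-lookup i))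
  lookup-unique (x∉ ∷ xs!) {suc i} {suc j} eq = cong suc (lookup-unique xs! eq)

module _ (V : FiniteSet) where
  open FiniteSet V

  joinClasses : ∀ es → Classes (EqClosure (Joined es))
  joinClasses [] = record
    { number     = ∣ V ∣
    ; class      = position
    ; surjective = λ k → lookup (elements V) k ,
        lookup-unique unique (sym (lookup-index (complete (lookup (elements V) k))))
    ; sound      = λ {u} {v} eq → subst (EqClosure (Joined []) u)
        (trans (lookup-index (complete u))
        (trans (cong (lookup (elements V)) eq)
               (sym (lookup-index (complete v))))) ε
    ; complete   = Eq.gfold isEquivalence position λ ()
    }
    where
    position : Carrier V → Fin ∣ V ∣
    position v = Any.index (complete v)
  joinClasses ((a , b) ∷ es) = addJoin a b es (joinClasses es)

Classes-number-≤ : ∀ {A : Set} {R S : Rel A 0ℓ} → (∀ {u v} → R u v → S u v) →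
                   (C : Classes R) (D : Classes S) → Classes.number D ≤ Classes.number C
Classes-number-≤ R⊆S C D = Fin.injective⇒≤ {f = f} f-injective
  where
  module C = Classes C
  module D = Classes D
  f : Fin D.number → Fin C.number
  f k = C.class (proj₁ (D.surjective k))
  f-injective : ∀ {k l} → f k ≡ f l → k ≡ l
  f-injective {k} {l} eq =
    trans (sym (proj₂ (D.surjective k)))
   (trans (D.complete (R⊆S (C.sound eq)))
          (proj₂ (D.surjective l)))

record Graph (V : FiniteSet) : Set₁ where
  infix 4 _∼_ _∼?_
  field
    _∼_      : Rel (Carrier V) 0ℓ
    _∼?_     : Decidable₂ _∼_
    ∼-sym    : Symmetric _∼_
    ∼-irrefl : ∀ {v} → ¬ (v ∼ v)

  ∼⇒≢ : ∀ {u v} → u ∼ v → u ≢ v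
  ∼⇒≢ u∼v refl = ∼-irrefl u∼v

module _ {V : FiniteSet} where
  open FiniteSet V using (_≟_)

  neighbours : Graph V → Carrier V → List (Carrier V)
  neighbours G v = filter (Graph._∼?_ G v) (elements V)

  degree : Graph V → Carrier V → ℕ
  degree G v = length (neighbours G v)

  edges : Graph V → List (Carrier V × Carrier V)
  edges G = filter (λ (u , v) → Graph._∼?_ G u v) (pairs (elements V))

  Reachable : Graph V → Rel (Carrier V) 0ℓ
  Reachable G = Star (Graph._∼_ G)

  -- The empty graph does not count as connected.
  Connected : Graph V → Set
  Connected G = Carrier V × (∀ u v → Reachable G u v)

  components : (G : Graph V) → Classes (Reachable G)
  components G = record
    { number     = number
    ; class      = class
    ; surjective = surjective
    ; sound      = λ eq → Eq.fold Reachable-isEquivalence (λ uv∈ → ∈-pairs⁻ uv∈ ◅ ε) (sound eq)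
    ; complete   = λ u⇝v → complete (Star.map (λ u∼v → fwd (∈-pairs⁺ u∼v)) u⇝v)
    }
    where
    open Graph G
    adjacentPairs : List (Carrier V × Carrier V)
    adjacentPairs = filter (λ (u , v) → u ∼? v) (cartesianProduct (elements V) (elements V))
    open Classes (joinClasses V adjacentPairs)
    ∈-pairs⁺ : ∀ {u v} → u ∼ v → (u , v) ∈ adjacentPairs
    ∈-pairs⁺ {u} {v} = ∈-filter⁺ (λ (u , v) → u ∼? v)
      (∈-cartesianProduct⁺ (FiniteSet.complete V u) (FiniteSet.complete V v))
    ∈-pairs⁻ : ∀ {u v} → (u , v) ∈ adjacentPairs → u ∼ v
    ∈-pairs⁻ uv∈ = proj₂ (∈-filter⁻ (λ (u , v) → u ∼? v)
      {xs = cartesianProduct (elements V) (elements V)} uv∈)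
    Reachable-isEquivalence : IsEquivalence (Reachable G)
    Reachable-isEquivalence = record
      { refl = ε ; sym = Star.reverse ∼-sym ; trans = Star._◅◅_ }

  componentCount : Graph V → ℕ
  componentCount G = Classes.number (components G)

  componentCount-antitone : ∀ (G H : Graph V) → (∀ {u v} → Graph._∼_ G u v → Graph._∼_ H u v) →
                            componentCount H ≤ componentCount G
  componentCount-antitone G H G⊆H = Classes-number-≤ (Star.map G⊆H) (components G) (components H)

  induced : Graph V → {P : Pred (Carrier V) 0ℓ} (P? : Decidable P) → Graph (subset V P?)
  induced G P? = record
    { _∼_      = λ u v → value u ∼ value v
    ; _∼?_     = λ u v → value u ∼? value v
    ; ∼-sym    = ∼-sym
    ; ∼-irrefl = ∼-irrefl
    }
    where open Graph G

  SameEdge : (a b u v : Carrier V) → Set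
  SameEdge a b u v = (u ≡ a × v ≡ b) ⊎ (u ≡ b × v ≡ a)

  deleteEdge : Graph V → (a b : Carrier V) → Graph V
  deleteEdge G a b = record
    { _∼_      = λ u v → u ∼ v × ¬ SameEdge a b u v
    ; _∼?_     = λ u v → (u ∼? v) ×-dec ¬? (((u ≟ a) ×-dec (v ≟ b)) ⊎-dec ((u ≟ b) ×-dec (v ≟ a)))
    ; ∼-sym    = λ (u∼v , ≠) → ∼-sym u∼v , ≠ ∘ [ (λ (p , q) → inj₂ (q , p)) , (λ (p , q) → inj₁ (q , p)) ]′
    ; ∼-irrefl = ∼-irrefl ∘ proj₁
    }
    where open Graph G

  CutEdge : Graph V → Rel (Carrier V) 0ℓ
  CutEdge G u v = Graph._∼_ G u v × componentCount G < componentCount (deleteEdge G u v)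

  cutEdge? : ∀ G → Decidable₂ (CutEdge G)
  cutEdge? G u v = Graph._∼?_ G u v ×-dec (componentCount G <? componentCount (deleteEdge G u v))

  CutEdge-sym : ∀ G → Symmetric (CutEdge G)
  CutEdge-sym G {u} {v} (u∼v , more) =
    Graph.∼-sym G u∼v ,
    subst (componentCount G <_)
      (≤-antisym (componentCount-antitone (deleteEdge G v u) (deleteEdge G u v) (swap v u))
                 (componentCount-antitone (deleteEdge G u v) (deleteEdge G v u) (swap u v))) more
    where
    swap : ∀ a b {x y} → Graph._∼_ (deleteEdge G a b) x y → Graph._∼_ (deleteEdge G b a) x y
    swap a b (x∼y , ≠) = x∼y , ≠ ∘ Sum.swap

  IsCycle : Graph V → Carrier V → List (Carrier V) → Set
  IsCycle G v vs = 2 ≤ length vs × Unique (v ∷ vs) × Linked (Graph._∼_ G) (v ∷ (vs ∷ʳ v))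

  Acyclic : Graph V → Set
  Acyclic G = ∀ v vs → ¬ IsCycle G v vs

  IsSpanningTree : Graph V → Graph V → Set
  IsSpanningTree G T =
    (∀ {u v} → Graph._∼_ T u v → Graph._∼_ G u v) × Connected T × Acyclic T

  branchVertices : Graph V → ℕ
  branchVertices T = count V (λ v → 2 <? degree T v)

record Minimisation (a : Level) : Set (lsuc a) where
  field
    Candidate : Set a
    Feasible  : Candidate → Set
    objective : Candidate → ℕ

  IsOptimal : Candidate → Set a
  IsOptimal s = Feasible s × (∀ s′ → Feasible s′ → objective s ≤ objective s′)

  IsOptimalValue : ℕ → Set a
  IsOptimalValue z = ∃ λ s → IsOptimal s × objective s ≡ z

minimumBranchVertices : {V : FiniteSet} → Graph V → Minimisation (lsuc 0ℓ)
minimumBranchVertices {V} G = record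
  { Candidate = Graph V
  ; Feasible  = IsSpanningTree G
  ; objective = branchVertices
  }

module Decomposition {V : FiniteSet} (G : Graph V) where
  open FiniteSet V using (_≟_)
  open Graph G

  deleteVertex : ∀ v → Graph (subset V (λ u → ¬? (u ≟ v)))
  deleteVertex v = induced G (λ u → ¬? (u ≟ v))

  α : Carrier V → ℕ
  α v = componentCount (deleteVertex v)

  Obligatory : Carrier V → Set
  Obligatory v = 3 ≤ α v

  obligatory? : Decidable Obligatory
  obligatory? v = 3 ≤? α v

  ∣Lₒ∣ : ℕ
  ∣Lₒ∣ = count V obligatory?

  γ : Carrier V → ℕ
  γ v = count V (cutEdge? G v)

  data Vertexₒ : Set where
    original : (v : Carrier V) → .(¬ Obligatory v) → Vertexₒ
    copy     : (v : Carrier V) → .(Obligatory v) → Fin (α v) → Vertexₒ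

  π : Vertexₒ → Carrier V
  π (original v _) = v
  π (copy v _ _)   = v

  Artificial : Vertexₒ → Set
  Artificial (original _ _) = ⊥
  Artificial (copy _ _ _)   = ⊤

  artificial? : Decidable Artificial
  artificial? (original _ _) = no λ ()
  artificial? (copy _ _ _)   = yes _

  _≟ₒ_ : DecidableEquality Vertexₒ
  original u _ ≟ₒ original v _ = map′ (λ { refl → refl }) (cong π) (u ≟ v)
  original _ _ ≟ₒ copy _ _ _   = no λ ()
  copy _ _ _   ≟ₒ original _ _ = no λ ()
  copy u _ i   ≟ₒ copy v _ j with u ≟ v
  ... | no  u≢v  = no (u≢v ∘ cong π)
  ... | yes refl = map′ (λ { refl → refl }) (λ { refl → refl }) (i Fin.≟ j)

  fibre : Carrier V → List Vertexₒ
  fibre v with obligatory? v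
  ... | yes o = map (copy v o) (allFin (α v))
  ... | no ¬o = original v ¬o ∷ []

  ∈-fibre : ∀ a → a ∈ fibre (π a)
  ∈-fibre (original v ¬o) with obligatory? v
  ... | yes o = ⊥-elim-irr (¬o o)
  ... | no  _ = here refl
  ∈-fibre (copy v o i) with obligatory? v
  ... | yes _ = ∈-map⁺ (copy v _) (∈-allFin i)
  ... | no ¬o = ⊥-elim-irr (¬o o)

  π-fibre : ∀ v {a} → a ∈ fibre v → π a ≡ v
  π-fibre v a∈ with obligatory? v
  π-fibre v a∈          | yes o with _ , _ , refl ← ∈-map⁻ (copy v o) a∈ = refl
  π-fibre v (here refl) | no  _ = refl

  Unique-fibre : ∀ v → Unique (fibre v)
  Unique-fibre v with obligatory? v
  ... | yes o = Unique.map⁺ (λ { refl → refl }) (Unique.allFin⁺ (α v))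
  ... | no  _ = [] ∷ []

  Vₒ : FiniteSet
  Vₒ = record
    { Carrier  = Vertexₒ
    ; _≟_      = _≟ₒ_
    ; elements = concatMap fibre (elements V)
    ; complete = λ a → ∈-concat⁺′ (∈-fibre a) (∈-map⁺ fibre (FiniteSet.complete V (π a)))
    ; unique   = Unique.concat⁺
        (All.map⁺ (All.universal Unique-fibre (elements V)))
        (AllPairs.map⁺ (AllPairs.map
          (λ u≢v {_} (a∈u , a∈v) → u≢v (trans (sym (π-fibre _ a∈u)) (π-fibre _ a∈v)))
          (FiniteSet.unique V)))
    }

  -- The vertex that replaces u as an end of an edge between u and v: if u is
  -- obligatory, the copy of u for the component of G - u that contains v.
  end : ∀ u v → .(v ≢ u) → Vertexₒ
  end u v v≢u with obligatory? u
  ... | yes o = copy u o (Classes.class (components (deleteVertex u)) (v , [ v≢u ]))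
  ... | no ¬o = original u ¬o

  Gₒ : Graph Vₒ
  Gₒ = record
    { _∼_      = _∼ₒ_
    ; _∼?_     = _∼ₒ?_
    ; ∼-sym    = λ (e , a≡ , b≡) → ∼-sym e , b≡ , a≡
    ; ∼-irrefl = λ (e , _) → ∼-irrefl e
    }
    where
    _∼ₒ_ : Rel Vertexₒ 0ℓ
    a ∼ₒ b = Σ (π a ∼ π b) λ e →
      a ≡ end (π a) (π b) (∼⇒≢ (∼-sym e)) × b ≡ end (π b) (π a) (∼⇒≢ e)
    _∼ₒ?_ : Decidable₂ _∼ₒ_
    a ∼ₒ? b with π a ∼? π b
    ... | no ¬e = no (¬e ∘ proj₁)
    ... | yes e = map′ (e ,_) (λ (_ , ends) → ends)
      ((a ≟ₒ end (π a) (π b) (∼⇒≢ (∼-sym e))) ×-dec (b ≟ₒ end (π b) (π a) (∼⇒≢ e)))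

  Gₒ′ : Graph Vₒ
  Gₒ′ = record
    { _∼_      = λ a b → Graph._∼_ Gₒ a b × ¬ CutEdge G (π a) (π b)
    ; _∼?_     = λ a b → Graph._∼?_ Gₒ a b ×-dec ¬? (cutEdge? G (π a) (π b))
    ; ∼-sym    = λ (a∼b , ¬cut) → Graph.∼-sym Gₒ a∼b , ¬cut ∘ CutEdge-sym G
    ; ∼-irrefl = Graph.∼-irrefl Gₒ ∘ proj₁
    }

  open Classes (components Gₒ′) public using () renaming (number to K; class to componentOf)

  Vₒ′[_] : Fin K → FiniteSet
  Vₒ′[ k ] = subset Vₒ (λ a → componentOf a Fin.≟ k)

  Gₒ′[_] : (k : Fin K) → Graph Vₒ′[ k ]
  Gₒ′[ k ] = induced Gₒ′ (λ a → componentOf a Fin.≟ k)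

  -- A 0/1 variable for each edge and each vertex; values of x at pairs that
  -- are not edges of the component occur nowhere below.
  record Assignment (k : Fin K) : Set where
    field
      x     : (a b : Carrier Vₒ′[ k ]) → Fin 2
      x-sym : ∀ a b → x a b ≡ x b a
      y     : Carrier Vₒ′[ k ] → Fin 2

  module _ {k : Fin K} where

    edgesWithin : (Carrier Vₒ′[ k ] → Bool) → List (Carrier Vₒ′[ k ] × Carrier Vₒ′[ k ])
    edgesWithin S = filter (λ (a , b) → T? (S a) ×-dec T? (S b)) (edges Gₒ′[ k ])

    -- Truncated subtraction is exact here: components and S are nonempty.
    record FeasibleAssignment (s : Assignment k) : Set where
      open Assignment s
      field
        edgeCount : ∑ (edges Gₒ′[ k ]) (λ (a , b) → toℕ (x a b)) ≡ ∣ Vₒ′[ k ] ∣ ∸ 1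
        subtour   : ∀ (S : Carrier Vₒ′[ k ] → Bool) → (∃ λ a → T (S a)) →
                    ∑ (edgesWithin S) (λ (a , b) → toℕ (x a b)) ≤ count Vₒ′[ k ] (T? ∘ S) ∸ 1
        branching : ∀ b → ¬ Artificial (value b) →
                    let v = π (value b) in
                    + (∑ (neighbours Gₒ′[ k ] b) (λ a → toℕ (x a b)) + γ v)
                      ℤ.≤ + 2 ℤ.+ (+ degree G v ℤ.- + 2) ℤ.* + toℕ (y b)

    branchSum : Assignment k → ℕ
    branchSum s = ∑ (filter (λ b → ¬? (artificial? (value b))) (elements Vₒ′[ k ]))
                   (λ b → toℕ (Assignment.y s b))

  componentProgram : Fin K → Minimisation 0ℓ
  componentProgram k = record
    { Candidate = Assignment k
    ; Feasible  = FeasibleAssignment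
    ; objective = branchSum
    }

  -- The cut edges of G together with the edges of G that correspond to the
  -- edges of the components chosen by the assignments.
  assemble : (∀ k → Assignment k) → Graph V
  assemble s = record
    { _∼_      = _∼ₛ_
    ; _∼?_     = λ u v → cutEdge? G u v ⊎-dec
        Fin.any? (λ k → ∃? Vₒ′[ k ] λ a → ∃? Vₒ′[ k ] λ b →
          Graph._∼?_ Gₒ′[ k ] a b ×-dec (x k a b Fin.≟ suc zero)
            ×-dec (π (value a) ≟ u) ×-dec (π (value b) ≟ v))
    ; ∼-sym    = [ inj₁ ∘ CutEdge-sym G
                 , (λ (k , a , b , a∼b , x≡1 , πa , πb) →
                     inj₂ (k , b , a , Graph.∼-sym Gₒ′[ k ] {a} {b} a∼b , trans (x-sym k b a) x≡1 , πb , πa)) ]′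
    ; ∼-irrefl = [ ∼-irrefl ∘ proj₁
                 , (λ { (_ , _ , _ , ((e , _) , _) , _ , πa , πb) →
                     ∼⇒≢ e (trans πa (sym πb)) }) ]′
    }
    where
    open module S k = Assignment (s k)
    _∼ₛ_ : Rel (Carrier V) 0ℓ
    u ∼ₛ v = CutEdge G u v ⊎
      (∃ λ k → ∃ λ a → ∃ λ b →
        Graph._∼_ Gₒ′[ k ] a b × x k a b ≡ suc zero × π (value a) ≡ u × π (value b) ≡ v)

{-# OPTIONS --safe #-}
module Submission where

-- A connected graph is a tree iff each of its edges is a bridge. If a path of G
-- together with an edge uv of G is a cycle, none of its edges is a cut edge, and
-- at every vertex w both of its edges lead into the same component of G - w; so
-- the cycle lifts to Gₒ′. Conversely, walks of Gₒ never change the component of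
-- G - w they live in, so a component of Gₒ′ contains at most one copy of w and
-- projects injectively to G. Hence the spanning trees of G are exactly the cut
-- edges together with one spanning tree of each component of Gₒ′, and the
-- component programs describe these trees by counting connectivity classes. An
-- obligatory branch has degree at least α(v) ≥ 3 in every spanning tree, and at
-- any other vertex the branching constraint bounds the degree in the assembled tree.

open import Defs
import Algebra.Properties.AbelianGroup as AbelianGroup
open import Data.Bool.Base using (Bool; true; false; T; if_then_else_)
open import Data.Bool.Properties using (T?)
open import Data.Empty using (⊥-elim-irr)
open import Data.Fin.Base using (Fin; zero; suc; toℕ)
import Data.Fin.Properties as Fin
open import Data.Integer.Base as ℤ using (+≤+)
import Data.Integer.Properties as ℤ
open import Data.Irrelevant using ([_])
open import Data.List.Base
  using ( List; []; _∷_; _++_; _∷ʳ_; map; filter; length; lookup; allFin; concat; tabulate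
        ; cartesianProduct; cartesianProductWith )
open import Data.List.Properties
  using ( filter-≐; filter-all; filter-notAll; map-cong; map-tabulate; tabulate-cong
        ; length-map; length-++; length-tabulate )
open import Data.List.Membership.Propositional using (_∈_; lose)
open import Data.List.Membership.Propositional.Properties
  using ( ∈-map⁺; ∈-map⁻; ∈-lookup; ∈-filter⁺; ∈-filter⁻; ∈-++⁺ˡ; ∈-++⁺ʳ; ∈-++⁻; ∈-length; ∈-allFin
        ; ∈-concat⁺′; ∈-concat⁻′; ∈-cartesianProduct⁺; ∈-cartesianProductWith⁺ )
open import Data.List.Relation.Binary.Subset.Propositional using (_⊆_)
open import Data.List.Relation.Unary.All as All using (All; []; _∷_)
import Data.List.Relation.Unary.All.Properties as All
open import Data.List.Relation.Unary.AllPairs as AllPairs using (AllPairs; []; _∷_)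
import Data.List.Relation.Unary.AllPairs.Properties as AllPairs
open import Data.List.Relation.Unary.Any as Any using (here; there)
open import Data.List.Relation.Unary.Any.Properties using (lookup-index)
open import Data.List.Relation.Unary.Linked using (Linked; []; [-]; _∷_)
open import Data.List.Relation.Unary.Unique.Propositional using (Unique)
import Data.List.Relation.Unary.Unique.Propositional.Properties as Unique
open import Data.Nat.Base using (ℕ; zero; suc; _+_; _∸_; _≤_; _<_; z≤n; s≤s)
open import Data.Nat.ListAction using (sum)
open import Data.Nat.Properties
  using ( ≤-reflexive; ≤-trans; ≤-antisym; ≤-totalOrder; <-irrefl; <⇒≱; ≮⇒≥; n≤1+n; +-identityʳ; +-suc
        ; +-comm; +-monoʳ-≤; +-monoˡ-≤; +-mono-≤; +-cancelʳ-≤; +-cancelʳ-≡; ∸-monoˡ-≤; m+[n∸m]≡n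
        ; _≤?_; _<?_; module ≤-Reasoning )
  renaming (_≟_ to _≟ℕ_)
open import Data.List.Extrema ≤-totalOrder using (argmin; argmin-all; f[argmin]≤f[xs])
open import Data.Product.Base using (Σ; ∃; _×_; _,_; proj₁; proj₂; swap)
open import Data.Refinement using (value; _,_)
open import Data.Sum.Base as Sum using (_⊎_; inj₁; inj₂; [_,_]′)
open import Data.Unit.Base using (⊤; tt)
open import Function.Base using (_∘_; id)
open import Level using (0ℓ)
open import Relation.Binary.Construct.Closure.Equivalence as Eq using (EqClosure)
open import Relation.Binary.Construct.Closure.ReflexiveTransitive as Star using (Star; ε; _◅_; _◅◅_)
open import Relation.Binary.Construct.Closure.Symmetric using (SymClosure; fwd; bwd)
open import Relation.Binary.Core using (Rel)
open import Relation.Binary.Definitions using (DecidableEquality)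
open import Relation.Binary.PropositionalEquality
open import Relation.Nullary using (Dec; yes; no; ¬_; contradiction)
open import Relation.Nullary.Decidable
  using (map′; _×-dec_; _⊎-dec_; _→-dec_; ¬?; ⌊_⌋; recompute; toWitness; fromWitness)
open import Relation.Unary using (Pred; Decidable)
open FiniteSet using (Carrier; elements)
open Minimisation using (IsOptimal; IsOptimalValue)

-- The bridge criterion speaks of reachability only, so a detour can be projected, lifted or
-- restricted edge by edge, whereas a cycle given as a list would have to be kept free of
-- repetitions at each transfer. The delicate direction is lifting. An arbitrary walk of `G` breaks
-- apart at an obligatory vertex, where consecutive edges may end at different copies; a cycle does
-- not, since the rest of it joins the two neighbours while missing that vertex. Hence walks are
-- lifted only between the two ends of an edge of `G`, with that edge closing the cycle. The
-- counting rests on one invariant: starting from `∣ W ∣` classes, each edge of a list removes at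
-- most one class, and exactly one if the list is a forest. Assignments contain functions, so
-- pointwise agreement replaces their equality, and optima are found in a finite enumeration up to
-- that relation.

-- Lists of vertices and of edges.

length-⊆ : ∀ {A : Set} {xs ys : List A} → Unique xs → xs ⊆ ys → length xs ≤ length ys
length-⊆ {xs = xs} {ys} xs! xs⊆ys = Fin.injective⇒≤ {f = position} λ {i} {j} eq →
  lookup-unique xs! (trans (lookup-index (xs⊆ys (∈-lookup i)))
    (trans (cong (lookup ys) eq) (sym (lookup-index (xs⊆ys (∈-lookup j))))))
  where
  position : Fin (length xs) → Fin (length ys)
  position i = Any.index (xs⊆ys (∈-lookup i))

length-set : ∀ {A : Set} {xs ys : List A} → Unique xs → Unique ys → xs ⊆ ys → ys ⊆ xs →
             length xs ≡ length ys
length-set xs! ys! ⊆ ⊇ = ≤-antisym (length-⊆ xs! ⊆) (length-⊆ ys! ⊇)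

module _ {A : Set} where

  length-filter-∁ : {P : Pred A 0ℓ} (P? : Decidable P) (xs : List A) →
                    length (filter P? xs) + length (filter (λ x → ¬? (P? x)) xs) ≡ length xs
  length-filter-∁ P? [] = refl
  length-filter-∁ P? (x ∷ xs) with P? x
  ... | yes _ = cong suc (length-filter-∁ P? xs)
  ... | no  _ = trans (+-suc _ _) (cong suc (length-filter-∁ P? xs))

  ∑-indicator : (f : A → Fin 2) (xs : List A) →
                ∑ xs (λ a → toℕ (f a)) ≡ length (filter (λ a → f a Fin.≟ suc zero) xs)
  ∑-indicator f [] = refl
  ∑-indicator f (x ∷ xs) with f x
  ... | zero     = ∑-indicator f xs
  ... | suc zero = cong suc (∑-indicator f xs)

  -- Unfolds to the negation of `SameEdge a b u v`, so a later edge of a list is an edge of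
  -- `deleteEdge H a b` without conversion.
  DifferentEdges : Rel (A × A) 0ℓ
  DifferentEdges (a , b) (u , v) = ¬ ((u ≡ a × v ≡ b) ⊎ (u ≡ b × v ≡ a))

  ∈-pairs⁻ : ∀ {xs : List A} {a b} → (a , b) ∈ pairs xs → a ∈ xs × b ∈ xs
  ∈-pairs⁻ {x ∷ xs} ab∈ with ∈-++⁻ (map (x ,_) xs) ab∈
  ... | inj₁ ab∈ˡ with _ , b∈ , refl ← ∈-map⁻ (x ,_) ab∈ˡ = here refl , there b∈
  ... | inj₂ ab∈ʳ = let a∈ , b∈ = ∈-pairs⁻ ab∈ʳ in there a∈ , there b∈

  ∈-pairs⁺ : ∀ {xs : List A} {a b} → a ∈ xs → b ∈ xs → a ≢ b →
             (a , b) ∈ pairs xs ⊎ (b , a) ∈ pairs xs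
  ∈-pairs⁺ (here refl) (here refl) a≢b = contradiction refl a≢b
  ∈-pairs⁺ (here refl) (there b∈)  a≢b = inj₁ (∈-++⁺ˡ (∈-map⁺ _ b∈))
  ∈-pairs⁺ (there a∈)  (here refl) a≢b = inj₂ (∈-++⁺ˡ (∈-map⁺ _ a∈))
  ∈-pairs⁺ (there a∈)  (there b∈)  a≢b =
    Sum.map (∈-++⁺ʳ _) (∈-++⁺ʳ _) (∈-pairs⁺ a∈ b∈ a≢b)

  pairs-different : ∀ {xs : List A} → Unique xs → AllPairs DifferentEdges (pairs xs)
  pairs-different {[]}     []         = []
  pairs-different {x ∷ xs} (x∉ ∷ xs!) = AllPairs.++⁺
    (AllPairs.map⁺ (local xs! λ y∈ z∈ y≢z → λ
      { (inj₁ (_ , z≡y)) → y≢z (sym z≡y)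
      ; (inj₂ (x≡y , _)) → All.lookup x∉ y∈ x≡y }))
    (pairs-different xs!)
    (All.map⁺ (All.tabulate λ y∈ → All.tabulate λ uv∈ → let u∈ , v∈ = ∈-pairs⁻ uv∈ in λ
      { (inj₁ (u≡x , _)) → All.lookup x∉ u∈ (sym u≡x)
      ; (inj₂ (_ , v≡x)) → All.lookup x∉ v∈ (sym v≡x) }))
    where
    local : ∀ {R S : Rel A 0ℓ} {ys} → AllPairs R ys →
            (∀ {y z} → y ∈ ys → z ∈ ys → R y z → S y z) → AllPairs S ys
    local []          f = []
    local (Ry ∷ Rys) f = All.tabulate (λ z∈ → f (here refl) (there z∈) (All.lookup Ry z∈))
                         ∷ local Rys (λ y∈ z∈ → f (there y∈) (there z∈))

  -- Acyclicity in incremental form: each edge joins two classes that the edges after it leave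
  -- separate, so adding it merges exactly two classes.
  data Forest : List (A × A) → Set where
    []  : Forest []
    _∷_ : ∀ {a b es} → ¬ EqClosure (Joined es) a b → Forest es → Forest ((a , b) ∷ es)

  addJoin-number : ∀ (a b : A) es (C : Classes (EqClosure (Joined es))) →
    let m = Classes.number C ; n = Classes.number (addJoin a b es C) in
    (EqClosure (Joined es) a b × n ≡ m) ⊎ m ≡ suc n
  addJoin-number a b es record { number = zero ; class = c } = contradiction (c a) Fin.¬Fin0
  addJoin-number a b es record { number = suc n ; class = c ; sound = sound } with c b Fin.≟ c a
  ... | yes cb≡ca = inj₁ (sound (sym cb≡ca) , refl)
  ... | no  _     = inj₂ refl

  EqClosure-isolated : {P : Pred A 0ℓ} {es : List (A × A)} →
    All (λ (a , b) → P a × P b) es → ∀ {u v} → EqClosure (Joined es) u v → ¬ P u → u ≡ v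
  EqClosure-isolated within ε               ¬Pu = refl
  EqClosure-isolated within (fwd uw∈ ◅ _) ¬Pu = contradiction (proj₁ (All.lookup within uw∈)) ¬Pu
  EqClosure-isolated within (bwd wu∈ ◅ _) ¬Pu = contradiction (proj₂ (All.lookup within wu∈)) ¬Pu

  length-filter-mono : ∀ {P Q : Pred A 0ℓ} (P? : Decidable P) (Q? : Decidable Q) {xs} →
    All (λ a → P a → Q a) xs → length (filter P? xs) ≤ length (filter Q? xs)
  length-filter-mono P? Q? [] = z≤n
  length-filter-mono P? Q? {x ∷ xs} (f ∷ fs) with P? x | Q? x
  ... | yes p | yes _ = s≤s (length-filter-mono P? Q? fs)
  ... | yes p | no ¬q = contradiction (f p) ¬q
  ... | no _  | yes _ = ≤-trans (length-filter-mono P? Q? fs) (n≤1+n _)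
  ... | no _  | no _  = length-filter-mono P? Q? fs

  ∈-map-elim : ∀ {B : Set} (P : Pred B 0ℓ) {f : A → B} {xs : List A} →
               (∀ {a} → a ∈ xs → P (f a)) → ∀ {b} → b ∈ map f xs → P b
  ∈-map-elim P Pf = All.lookup (All.map⁺ (All.tabulate Pf))

  length-concat : (xss : List (List A)) → length (concat xss) ≡ sum (map length xss)
  length-concat []         = refl
  length-concat (xs ∷ xss) = trans (length-++ xs) (cong (_+_ (length xs)) (length-concat xss))

sum-tabulate-mono : ∀ {n} {f g : Fin n → ℕ} → (∀ i → f i ≤ g i) → sum (tabulate f) ≤ sum (tabulate g)
sum-tabulate-mono {zero}  f≤g = z≤n
sum-tabulate-mono {suc n} f≤g = +-mono-≤ (f≤g zero) (sum-tabulate-mono (f≤g ∘ suc))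

-- 0/1 indicators and enumeration of functions on a finite list.

indicator : ∀ {P : Set} → Dec P → Fin 2
indicator (yes _) = suc zero
indicator (no  _) = zero

indicator⁺ : ∀ {P : Set} (P? : Dec P) → P → indicator P? ≡ suc zero
indicator⁺ (yes _) _ = refl
indicator⁺ (no ¬p) p = contradiction p ¬p

indicator⁻ : ∀ {P : Set} (P? : Dec P) → indicator P? ≡ suc zero → P
indicator⁻ (yes p) _ = p

indicator-cong : ∀ {P Q : Set} (P? : Dec P) (Q? : Dec Q) → (P → Q) → (Q → P) → indicator P? ≡ indicator Q?
indicator-cong (yes _) (yes _) _ _ = refl
indicator-cong (yes p) (no ¬q) f _ = contradiction (f p) ¬q
indicator-cong (no ¬p) (yes q) _ g = contradiction (g q) ¬p
indicator-cong (no _)  (no _)  _ _ = refl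

module _ {A : Set} (_≟_ : DecidableEquality A) {B : Set} where

  functions : B → List B → List A → List (A → B)
  functions d bs []       = (λ _ → d) ∷ []
  functions d bs (x ∷ xs) =
    cartesianProductWith (λ b f a → if ⌊ a ≟ x ⌋ then b else f a) bs (functions d bs xs)

  -- `_≈_` stands in for equality because `B` may itself be a function type, as it is for the
  -- two-argument `x` of an assignment; the enumeration reaches such values only up to pointwise
  -- agreement.
  functions-complete : ∀ d bs (_≈_ : Rel B 0ℓ) (g : A → B) → (∀ a → ∃ λ b → b ∈ bs × b ≈ g a) → ∀ xs →
    ∃ λ f → f ∈ functions d bs xs × (∀ {a} → a ∈ xs → f a ≈ g a)
  functions-complete d bs _≈_ g covered [] = (λ _ → d) , here refl , λ ()
  functions-complete d bs _≈_ g covered (x ∷ xs) =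
    let b , b∈ , b≈ = covered x
        f , f∈ , f≈ = functions-complete d bs _≈_ g covered xs
        updated : ∀ {a} → a ∈ x ∷ xs → (if ⌊ a ≟ x ⌋ then b else f a) ≈ g a
        updated {a} a∈ = agree {b} {f} b≈ f≈ a∈ (a ≟ x)
    in (λ a → if ⌊ a ≟ x ⌋ then b else f a) , ∈-cartesianProductWith⁺ _ b∈ f∈ , updated
    where
    agree : ∀ {b} {f : A → B} → b ≈ g x → (∀ {a} → a ∈ xs → f a ≈ g a) →
            ∀ {a} → a ∈ x ∷ xs → (a≟x : Dec (a ≡ x)) → (if ⌊ a≟x ⌋ then b else f a) ≈ g a
    agree b≈ f≈ a∈           (yes refl) = b≈
    agree b≈ f≈ (here a≡x)   (no a≢x)   = contradiction a≡x a≢x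
    agree b≈ f≈ (there a∈)   (no _)     = f≈ a∈

-- Forests and connectivity classes

module _ (W : FiniteSet) where

  private
    number : List (Carrier W × Carrier W) → ℕ
    number es = Classes.number (joinClasses W es)

  joinClasses-≥ : ∀ es → ∣ W ∣ ≤ number es + length es
  joinClasses-≥ [] = ≤-reflexive (sym (+-identityʳ _))
  joinClasses-≥ ((a , b) ∷ es) with addJoin-number a b es (joinClasses W es)
  ... | inj₁ (_ , n≡m) rewrite n≡m = ≤-trans (joinClasses-≥ es) (+-monoʳ-≤ (number es) (n≤1+n _))
  ... | inj₂ m≡1+n = ≤-trans (joinClasses-≥ es)
    (≤-reflexive (trans (cong (_+ length es) m≡1+n) (sym (+-suc _ _))))

  joinClasses-forest : ∀ {es} → Forest es → number es + length es ≡ ∣ W ∣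
  joinClasses-forest [] = +-identityʳ _
  joinClasses-forest {(a , b) ∷ es} (a≁b ∷ f) with addJoin-number a b es (joinClasses W es)
  ... | inj₁ (a~b , _) = contradiction a~b a≁b
  ... | inj₂ m≡1+n = trans (+-suc _ _) (trans (cong (_+ length es) (sym m≡1+n)) (joinClasses-forest f))

  -- The edges lie inside P, so every vertex outside P is a class of its own;
  -- one element s of P completes these vertices to a transversal.
  module _ {P : Pred (Carrier W) 0ℓ} (P? : Decidable P) {es : List (Carrier W × Carrier W)}
           (within : All (λ (a , b) → P a × P b) es) {s : Carrier W} (Ps : P s) where

    private
      open module C = Classes (joinClasses W es) using (class)

      outside : List (Carrier W)
      outside = filter (λ v → ¬? (P? v)) (elements W)

      complement : count W P? + length outside ≡ ∣ W ∣
      complement = length-filter-∁ P? (elements W)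

      outside-¬P : ∀ {v} → v ∈ outside → ¬ P v
      outside-¬P v∈ = proj₂ (∈-filter⁻ (λ v → ¬? (P? v)) {xs = elements W} v∈)

    classes-≥ : suc (length outside) ≤ number es
    classes-≥ = Fin.injective⇒≤ {f = class ∘ lookup (s ∷ outside)} λ {i} {j} eq →
      lookup-unique transversal! (separated (∈-lookup i) (∈-lookup j) (C.sound eq))
      where
      transversal! : Unique (s ∷ outside)
      transversal! = All.tabulate (λ v∈ s≡v → outside-¬P v∈ (subst P s≡v Ps))
        ∷ Unique.filter⁺ (λ v → ¬? (P? v)) (FiniteSet.unique W)
      separated : ∀ {u v} → u ∈ s ∷ outside → v ∈ s ∷ outside → EqClosure (Joined es) u v → u ≡ v
      separated (here refl) (here refl) _   = refl
      separated (there u∈)  _           u~v = EqClosure-isolated within u~v (outside-¬P u∈)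
      separated (here refl) (there v∈)  u~v =
        sym (EqClosure-isolated within (Eq.symmetric _ u~v) (outside-¬P v∈))

    classes-≤ : (∀ {v} → P v → EqClosure (Joined es) s v) → number es ≤ suc (length outside)
    classes-≤ joined = begin
      number es                              ≡⟨ length-tabulate id ⟨
      length (allFin (number es))            ≤⟨ length-⊆ (Unique.allFin⁺ _) (λ {k} _ → hit k) ⟩
      length (map class (s ∷ outside))       ≡⟨ length-map class (s ∷ outside) ⟩
      suc (length outside)                   ∎
      where
      open ≤-Reasoning
      hit : ∀ k → k ∈ map class (s ∷ outside)
      hit k with C.surjective k
      ... | v , refl with P? v
      ...   | yes Pv = here (C.complete (Eq.symmetric _ (joined Pv)))
      ...   | no ¬Pv = there (∈-map⁺ class (∈-filter⁺ (λ v → ¬? (P? v)) (FiniteSet.complete W v) ¬Pv))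

    -- Classes are counted in all of `W`; the vertices outside `P` are isolated and cancel on both
    -- sides. This handles a vertex set `S` of a subtour constraint without forming the subgraph on
    -- it.
    forest-≤ : Forest es → suc (length es) ≤ count W P?
    forest-≤ f = +-cancelʳ-≤ (length outside) (suc (length es)) _ (begin
      suc (length es) + length outside ≡⟨ +-comm (suc (length es)) _ ⟩
      length outside + suc (length es) ≡⟨ +-suc _ _ ⟩
      suc (length outside) + length es ≤⟨ +-monoˡ-≤ (length es) classes-≥ ⟩
      number es + length es            ≡⟨ joinClasses-forest f ⟩
      ∣ W ∣                            ≡⟨ complement ⟨
      count W P? + length outside      ∎)
      where open ≤-Reasoning

    connecting-≥ : (∀ {v} → P v → EqClosure (Joined es) s v) → count W P? ≤ suc (length es)
    connecting-≥ joined = +-cancelʳ-≤ (length outside) _ (suc (length es)) (begin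
      count W P? + length outside      ≡⟨ complement ⟩
      ∣ W ∣                            ≤⟨ joinClasses-≥ es ⟩
      number es + length es            ≤⟨ +-monoˡ-≤ (length es) (classes-≤ joined) ⟩
      suc (length outside) + length es ≡⟨ +-suc _ _ ⟨
      length outside + suc (length es) ≡⟨ +-comm (length outside) _ ⟩
      suc (length es) + length outside ∎)
      where open ≤-Reasoning

-- Walks and bridges

nodes : ∀ {A : Set} {R : Rel A 0ℓ} {u v} → Star R u v → List A
nodes {u = u} ε       = u ∷ []
nodes {u = u} (_ ◅ p) = u ∷ nodes p

-- Walks of `G - w` kept as walks of `G`. An empty walk says nothing about its endpoint, so the
-- inequality with `w` is passed separately where it matters.
Avoiding : ∀ {A : Set} → Rel A 0ℓ → A → Rel A 0ℓ
Avoiding R w x y = R x y × x ≢ w × y ≢ w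

module _ {A : Set} {R : Rel A 0ℓ} where

  source∈nodes : ∀ {u v} (p : Star R u v) → u ∈ nodes p
  source∈nodes ε       = here refl
  source∈nodes (_ ◅ _) = here refl

  target∈nodes : ∀ {u v} (p : Star R u v) → v ∈ nodes p
  target∈nodes ε       = here refl
  target∈nodes (_ ◅ p) = there (target∈nodes p)

  suffix : ∀ {u v w} (p : Star R u v) → Unique (nodes p) → w ∈ nodes p →
           ∃ λ (q : Star R w v) → Unique (nodes q)
  suffix ε         p!       (here refl) = ε , p!
  suffix p@(_ ◅ _) p!       (here refl) = p , p!
  suffix (_ ◅ p)   (_ ∷ p!) (there w∈)  = suffix p p! w∈

  avoiding : ∀ {u v w} (p : Star R u v) → All (w ≢_) (nodes p) → Star (Avoiding R w) u v
  avoiding ε _ = ε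
  avoiding (e ◅ p) (w≢u ∷ w∉p) =
    (e , w≢u ∘ sym , All.lookup w∉p (source∈nodes p) ∘ sym) ◅ avoiding p w∉p

  module _ (_≟_ : DecidableEquality A) where
    open import Data.List.Membership.DecPropositional _≟_ using (_∈?_)

    -- Loop erasure: if the new first vertex already lies on the simplified tail, the walk is
    -- replaced by the tail's suffix from there.
    simple : ∀ {u v} → Star R u v → ∃ λ (p : Star R u v) → Unique (nodes p)
    simple ε = ε , [] ∷ []
    simple {u} (e ◅ p) with simple p
    ... | q , q! with u ∈? nodes q
    ...   | yes u∈ = suffix q q! u∈
    ...   | no  u∉ = e ◅ q , All.¬Any⇒All¬ _ u∉ ∷ q!

module _ {V : FiniteSet} where

  Bridges : Graph V → Set
  Bridges H = ∀ {u v} → Graph._∼_ H u v → ¬ Reachable (deleteEdge H u v) u v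

  reachable? : (H : Graph V) → ∀ u v → Dec (Reachable H u v)
  reachable? H u v = map′ sound complete (class u Fin.≟ class v)
    where open Classes (components H)

  -- A simple detour around `uv` has at least two edges: with none, `uv` would be a loop, and a
  -- single edge would be the deleted one. Closing it by `vu` gives a cycle.
  acyclic⇒bridges : (H : Graph V) → Acyclic H → Bridges H
  acyclic⇒bridges H acyclic {u} {v} u∼v u⇝v with simple (FiniteSet._≟_ V) u⇝v
  ... | ε , _                    = Graph.∼-irrefl H u∼v
  ... | (e , ≢uv) ◅ ε , _        = ≢uv (inj₁ (refl , refl))
  ... | (e , _) ◅ p@(_ ◅ q) , p! = acyclic u (nodes p)
    (s≤s (≤-trans (s≤s z≤n) (nonempty q)) , p! , e ∷ closed p)
    where
    open Graph H
    nonempty : ∀ {x y} (r : Reachable (deleteEdge H u v) x y) → 1 ≤ length (nodes r)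
    nonempty ε       = s≤s z≤n
    nonempty (_ ◅ _) = s≤s z≤n
    closed : ∀ {x} (r : Reachable (deleteEdge H u v) x v) → Linked _∼_ (nodes r ∷ʳ u)
    closed ε                       = ∼-sym u∼v ∷ [-]
    closed ((f , _) ◅ ε)           = f ∷ ∼-sym u∼v ∷ [-]
    closed ((f , _) ◅ r@(_ ◅ _))   = f ∷ closed r

  -- The rest of the cycle leads from `w` back to `v`, and since no vertex repeats, none of its
  -- edges is `vw`; so `vw` would not be a bridge.
  bridges⇒acyclic : (H : Graph V) → Bridges H → Acyclic H
  bridges⇒acyclic H bridges v []       (() , _)
  bridges⇒acyclic H bridges v (w ∷ []) (s≤s () , _)
  bridges⇒acyclic H bridges v (w ∷ x ∷ vs) (_ , (v∉ ∷ w∉ ∷ xs!) , v∼w ∷ w∼x ∷ rest) =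
    bridges v∼w (Star.reverse (Graph.∼-sym (deleteEdge H v w))
      ((w∼x , λ { (inj₁ (w≡v , _)) → v≢w (sym w≡v) ; (inj₂ (_ , x≡v)) → v≢x (sym x≡v) })
       ◅ go x vs v∉vs w∉ rest))
    where
    open Graph H
    v≢w = All.head v∉
    v≢x = All.head (All.tail v∉)
    v∉vs = All.tail v∉
    go : ∀ y ys → All (v ≢_) (y ∷ ys) → All (w ≢_) (y ∷ ys) → Linked _∼_ (y ∷ (ys ∷ʳ v)) →
         Reachable (deleteEdge H v w) y v
    go y [] (v≢y ∷ _) (w≢y ∷ _) (y∼v ∷ _) =
      (y∼v , λ { (inj₁ (y≡v , _)) → v≢y (sym y≡v) ; (inj₂ (y≡w , _)) → w≢y (sym y≡w) }) ◅ ε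
    go y (z ∷ zs) (v≢y ∷ v∉) (w≢y ∷ w∉) (y∼z ∷ zs∼) =
      (y∼z , λ { (inj₁ (y≡v , _)) → v≢y (sym y≡v) ; (inj₂ (y≡w , _)) → w≢y (sym y≡w) })
      ◅ go z zs v∉ w∉ zs∼

  -- The edges after `ab` all survive in `deleteEdge H a b`; if they joined `a` to `b`, they would
  -- form a detour around a bridge.
  bridges⇒forest : (H : Graph V) → Bridges H → ∀ {es} → All (λ (a , b) → Graph._∼_ H a b) es →
                   AllPairs DifferentEdges es → Forest es
  bridges⇒forest H bridges []            []          = []
  bridges⇒forest H bridges {(a , b) ∷ es} (a∼b ∷ es∼) (ab≢ ∷ es≢) =
    (λ a~b → bridges a∼b (Star.map step a~b)) ∷ bridges⇒forest H bridges es∼ es≢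
    where
    open Graph (deleteEdge H a b)
    joined : ∀ {x y} → (x , y) ∈ es → x ∼ y
    joined xy∈ = All.lookup es∼ xy∈ , All.lookup ab≢ xy∈
    step : ∀ {x y} → SymClosure (Joined es) x y → x ∼ y
    step (fwd xy∈) = joined xy∈
    step (bwd yx∈) = ∼-sym (joined yx∈)

  bypass : (H : Graph V) → ∀ {a b} → Reachable (deleteEdge H a b) a b →
           ∀ {u v} → Graph._∼_ H u v → Reachable (deleteEdge H a b) u v
  bypass H {a} {b} a⇝b {u} {v} u∼v with FiniteSet._≟_ V u a ×-dec FiniteSet._≟_ V v b
                                      | FiniteSet._≟_ V u b ×-dec FiniteSet._≟_ V v a
  ... | yes (refl , refl) | _ = a⇝b
  ... | no _ | yes (refl , refl) = Star.reverse (Graph.∼-sym (deleteEdge H a b)) a⇝b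
  ... | no ≢ab | no ≢ba = (u∼v , [ ≢ab , ≢ba ]′) ◅ ε

  -- A detour can replace the edge in every walk, so deleting the edge would leave no more
  -- components than before.
  cutEdge⇒bridge : (H : Graph V) → ∀ {u v} → CutEdge H u v → ¬ Reachable (deleteEdge H u v) u v
  cutEdge⇒bridge H {u} {v} (u∼v , more) u⇝v = <⇒≱ more
    (Classes-number-≤ (Star._>>= bypass H u⇝v) (components H) (components (deleteEdge H u v)))

  -- Deleting an edge that is not a bridge preserves reachability by `bypass`, and a bridge stays
  -- one when other edges are deleted. So one pass over all pairs leaves only bridges.
  spanningTree : (G : Graph V) → Connected G → ∃ (IsSpanningTree G)
  spanningTree G (v₀ , connected) =
    let T , T⊆G , T-connected , T-bridges = prune allPairs
    in T , T⊆G , (v₀ , T-connected) , bridges⇒acyclic T λ {u} {v} u∼v →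
         T-bridges (∈-cartesianProduct⁺ (FiniteSet.complete V u) (FiniteSet.complete V v)) u∼v
    where
    allPairs = cartesianProduct (elements V) (elements V)
    prune : ∀ es → Σ (Graph V) λ T → (∀ {u v} → Graph._∼_ T u v → Graph._∼_ G u v) ×
            (∀ u v → Reachable T u v) ×
            (∀ {u v} → (u , v) ∈ es → Graph._∼_ T u v → ¬ Reachable (deleteEdge T u v) u v)
    prune [] = G , id , connected , λ ()
    prune ((a , b) ∷ es) with prune es
    ... | T , T⊆G , T-connected , T-bridges with reachable? (deleteEdge T a b) a b
    ...   | no  a↛b = T , T⊆G , T-connected , λ { (here refl) _ → a↛b ; (there uv∈) → T-bridges uv∈ }
    ...   | yes a⇝b = deleteEdge T a b , T⊆G ∘ proj₁
      , (λ u v → (T-connected u v) Star.>>= bypass T a⇝b)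
      , λ { (here refl) (_ , ≢ab) → contradiction (inj₁ (refl , refl)) ≢ab
          ; (there uv∈) (u∼v , _) → T-bridges uv∈ u∼v ∘ Star.map (λ ((e , _) , ≢uv) → e , ≢uv) }

degree-mono : ∀ {V : FiniteSet} (G H : Graph V) {v} → (∀ {u} → Graph._∼_ G v u → Graph._∼_ H v u) →
              degree G v ≤ degree H v
degree-mono {V} G H {v} G⊆H =
  length-filter-mono (Graph._∼?_ G v) (Graph._∼?_ H v) (All.universal (λ _ → G⊆H) (elements V))

-- The integer program as a description of trees

module _ {W : FiniteSet} (H : Graph W) (x : Carrier W → Carrier W → Fin 2)
         (x-sym : ∀ a b → x a b ≡ x b a) where
  open Graph H

  chosen : Graph W
  chosen = record
    { _∼_      = λ a b → a ∼ b × x a b ≡ suc zero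
    ; _∼?_     = λ a b → (a ∼? b) ×-dec (x a b Fin.≟ suc zero)
    ; ∼-sym    = λ {a} {b} (a∼b , xab) → ∼-sym a∼b , trans (x-sym b a) xab
    ; ∼-irrefl = ∼-irrefl ∘ proj₁
    }

  private
    Within : (Carrier W → Bool) → Carrier W × Carrier W → Set
    Within S (a , b) = T (S a) × T (S b)

    within? : ∀ S → Decidable (Within S)
    within? S (a , b) = T? (S a) ×-dec T? (S b)

    edge? : Decidable (λ ((a , b) : Carrier W × Carrier W) → a ∼ b)
    edge? (a , b) = a ∼? b

    one? : Decidable (λ ((a , b) : Carrier W × Carrier W) → x a b ≡ suc zero)
    one? (a , b) = x a b Fin.≟ suc zero

    chosenWithin : (Carrier W → Bool) → List (Carrier W × Carrier W)
    chosenWithin S = filter one? (filter (within? S) (edges H))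

    chosenEdges : List (Carrier W × Carrier W)
    chosenEdges = filter one? (edges H)

    ∈-edges⁻ : ∀ {a b} → (a , b) ∈ edges H → a ∼ b
    ∈-edges⁻ ab∈ = proj₂ (∈-filter⁻ edge? {xs = pairs (elements W)} ab∈)

    ∈-edges⁺ : ∀ {a b} → a ∼ b → (a , b) ∈ edges H ⊎ (b , a) ∈ edges H
    ∈-edges⁺ a∼b = Sum.map (λ ab∈ → ∈-filter⁺ edge? ab∈ a∼b) (λ ba∈ → ∈-filter⁺ edge? ba∈ (∼-sym a∼b))
      (∈-pairs⁺ (FiniteSet.complete W _) (FiniteSet.complete W _) (∼⇒≢ a∼b))

    edges-different : AllPairs DifferentEdges (edges H)
    edges-different = AllPairs.filter⁺ edge? (pairs-different (FiniteSet.unique W))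

    ∈-chosenEdges⁻ : ∀ {a b} → (a , b) ∈ chosenEdges → Graph._∼_ chosen a b
    ∈-chosenEdges⁻ ab∈ = let ab∈′ , xab = ∈-filter⁻ one? {xs = edges H} ab∈ in ∈-edges⁻ ab∈′ , xab

    ∈-chosenWithin⁻ : ∀ S {a b} → (a , b) ∈ chosenWithin S → Graph._∼_ chosen a b × Within S (a , b)
    ∈-chosenWithin⁻ S ab∈ with ∈-filter⁻ one? {xs = filter (within? S) (edges H)} ab∈
    ... | ab∈′ , xab with ∈-filter⁻ (within? S) {xs = edges H} ab∈′
    ...   | ab∈″ , wab = (∈-edges⁻ ab∈″ , xab) , wab

    ∈-chosenWithin⁺ : ∀ S {a b} → Graph._∼_ chosen a b → T (S a) → T (S b) →
                      (a , b) ∈ chosenWithin S ⊎ (b , a) ∈ chosenWithin S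
    ∈-chosenWithin⁺ S {a} {b} (a∼b , xab) Sa Sb = Sum.map
      (λ ab∈ → ∈-filter⁺ one? (∈-filter⁺ (within? S) ab∈ (Sa , Sb)) xab)
      (λ ba∈ → ∈-filter⁺ one? (∈-filter⁺ (within? S) ba∈ (Sb , Sa)) (trans (x-sym b a) xab))
      (∈-edges⁺ a∼b)

    chosenEdges-forest : Bridges chosen → Forest chosenEdges
    chosenEdges-forest bridges = bridges⇒forest chosen bridges (All.tabulate ∈-chosenEdges⁻)
      (AllPairs.filter⁺ one? edges-different)

    chosenEdges-joined : ∀ {a b} → Reachable chosen a b → EqClosure (Joined chosenEdges) a b
    chosenEdges-joined = Star.map λ {a} {b} (a∼b , xab) →
      [ (λ ab∈ → fwd (∈-filter⁺ one? ab∈ xab))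
      , (λ ba∈ → bwd (∈-filter⁺ one? ba∈ (trans (x-sym b a) xab))) ]′ (∈-edges⁺ a∼b)

    all? : Decidable (λ (_ : Carrier W) → ⊤)
    all? _ = yes tt

    count-all : count W all? ≡ ∣ W ∣
    count-all = cong length (filter-all all? {xs = elements W} (All.universal (λ _ → tt) _))

  -- The bounds for forests and for connecting edge lists, with `P` all of `W`, meet.
  tree⇒edgeCount : Connected chosen → Bridges chosen → ∑ (edges H) (λ (a , b) → toℕ (x a b)) ≡ ∣ W ∣ ∸ 1
  tree⇒edgeCount (v , connected) bridges = trans (∑-indicator (λ (a , b) → x a b) (edges H))
    (cong (_∸ 1) (trans (≤-antisym (forest-≤ W all? inside {v} tt (chosenEdges-forest bridges))
                                   (connecting-≥ W all? inside {v} tt λ {w} _ → chosenEdges-joined (connected v w)))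
                        count-all))
    where
    inside : All (λ (a , b) → ⊤ × ⊤) chosenEdges
    inside = All.universal (λ _ → tt , tt) chosenEdges

  bridges⇒subtour : Bridges chosen → ∀ (S : Carrier W → Bool) → (∃ λ a → T (S a)) →
    ∑ (filter (within? S) (edges H)) (λ (a , b) → toℕ (x a b)) ≤ count W (T? ∘ S) ∸ 1
  bridges⇒subtour bridges S (v , Sv) =
    ≤-trans (≤-reflexive (∑-indicator (λ (a , b) → x a b) (filter (within? S) (edges H))))
      (∸-monoˡ-≤ 1 (forest-≤ W (T? ∘ S) (All.tabulate (proj₂ ∘ ∈-chosenWithin⁻ S)) Sv
        (bridges⇒forest chosen bridges (All.tabulate (proj₁ ∘ ∈-chosenWithin⁻ S))
          (AllPairs.filter⁺ one? (AllPairs.filter⁺ (within? S) edges-different)))))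

  -- If the chosen edge ab were not a bridge, the vertices reachable from a
  -- without it would form a set S violating the subtour constraint.
  subtour⇒bridges : (∀ (S : Carrier W → Bool) → (∃ λ a → T (S a)) →
    ∑ (filter (within? S) (edges H)) (λ (a , b) → toℕ (x a b)) ≤ count W (T? ∘ S) ∸ 1) → Bridges chosen
  subtour⇒bridges subtour {a} {b} a∼b a⇝b = <-irrefl refl (begin-strict
    length others                     <⟨ filter-notAll other? (chosenWithin S) ab∈ ⟩
    length (chosenWithin S)           ≡⟨ ∑-indicator (λ (a , b) → x a b) (filter (within? S) (edges H)) ⟨
    ∑ (filter (within? S) (edges H)) (λ (a , b) → toℕ (x a b)) ≤⟨ subtour S (a , Sa) ⟩
    -- The edges other than `ab` still connect `S`, so they alone number at least `|S| - 1`;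
    -- counting `ab` as well exceeds the subtour bound.
    count W (T? ∘ S) ∸ 1              ≤⟨ ∸-monoˡ-≤ 1 (connecting-≥ W (T? ∘ S)
                                           (All.tabulate λ uv∈ → proj₂ (∈-chosenWithin⁻ S (proj₁ (∈-filter⁻ other? uv∈))))
                                           Sa (λ Sv → joined (toWitness Sv) ε)) ⟩
    length others                     ∎)
    where
    open ≤-Reasoning
    rest : Graph W
    rest = deleteEdge chosen a b
    S : Carrier W → Bool
    S v = ⌊ reachable? rest a v ⌋
    S⁺ : ∀ {v} → Reachable rest a v → T (S v)
    S⁺ {v} = fromWitness {a? = reachable? rest a v}
    Sa : T (S a)
    Sa = S⁺ ε
    other? : Decidable (λ ((u , v) : Carrier W × Carrier W) → ¬ SameEdge {W} a b u v)
    other? (u , v) = ¬? (((u FW.≟ a) ×-dec (v FW.≟ b)) ⊎-dec ((u FW.≟ b) ×-dec (v FW.≟ a)))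
      where module FW = FiniteSet W
    others : List (Carrier W × Carrier W)
    others = filter other? (chosenWithin S)
    ab∈ : Any.Any (λ (u , v) → ¬ ¬ SameEdge {W} a b u v) (chosenWithin S)
    ab∈ = [ (λ ab∈ → lose ab∈ (λ ≢ab → ≢ab (inj₁ (refl , refl))))
          , (λ ba∈ → lose ba∈ (λ ≢ab → ≢ab (inj₂ (refl , refl)))) ]′ (∈-chosenWithin⁺ S a∼b Sa (S⁺ a⇝b))
    joined : ∀ {u v} → Reachable rest u v → Reachable rest a u → EqClosure (Joined others) u v
    joined ε a⇝u = ε
    joined {u} (_◅_ {j = w} (u∼w , ≢ab) w⇝v) a⇝u =
      [ (λ uw∈ → fwd (∈-filter⁺ other? uw∈ ≢ab))
      , (λ wu∈ → bwd (∈-filter⁺ other? wu∈ (≢ab ∘ [ inj₂ ∘ swap , inj₁ ∘ swap ]′))) ]′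
        (∈-chosenWithin⁺ S u∼w (S⁺ a⇝u) (S⁺ a⇝w)) ◅ joined w⇝v a⇝w
      where a⇝w = a⇝u ◅◅ ((u∼w , ≢ab) ◅ ε)

  -- In a forest, classes and edges add up to `∣ W ∣`, so this many edges leave a single class. The
  -- vertex given as argument makes the truncated subtraction exact.
  edgeCount⇒connected : Carrier W → Bridges chosen →
    ∑ (edges H) (λ (a , b) → toℕ (x a b)) ≡ ∣ W ∣ ∸ 1 → Connected chosen
  edgeCount⇒connected v bridges edgeCount = v , λ u w →
    Star.gmap id step (C.sound (single number≡1 (C.class u) (C.class w)))
    where
    module C = Classes (joinClasses W chosenEdges)
    number≡1 : C.number ≡ 1
    number≡1 = +-cancelʳ-≡ (∣ W ∣ ∸ 1) C.number 1 (begin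
      C.number + (∣ W ∣ ∸ 1)      ≡⟨ cong (C.number +_) edgeCount ⟨
      C.number + ∑ (edges H) (λ (a , b) → toℕ (x a b))
                                  ≡⟨ cong (C.number +_) (∑-indicator (λ (a , b) → x a b) (edges H)) ⟩
      C.number + length chosenEdges ≡⟨ joinClasses-forest W (chosenEdges-forest bridges) ⟩
      ∣ W ∣                       ≡⟨ m+[n∸m]≡n (∈-length (FiniteSet.complete W v)) ⟨
      1 + (∣ W ∣ ∸ 1)             ∎)
      where open ≡-Reasoning
    single : ∀ {n} → n ≡ 1 → (i j : Fin n) → i ≡ j
    single refl zero zero = refl
    step : ∀ {a b} → SymClosure (Joined chosenEdges) a b → Graph._∼_ chosen a b
    step (fwd ab∈) = ∈-chosenEdges⁻ ab∈
    step (bwd ba∈) = Graph.∼-sym chosen (∈-chosenEdges⁻ ba∈)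

-- The branching constraint in terms of degrees.

private
  2+[d-2]≡d : ∀ d → ℤ.+ 2 ℤ.+ (ℤ.+ d ℤ.- ℤ.+ 2) ≡ ℤ.+ d
  2+[d-2]≡d d = trans (sym (ℤ.+-assoc (ℤ.+ 2) (ℤ.+ d) (ℤ.- (ℤ.+ 2))))
    (AbelianGroup.xyx⁻¹≈y ℤ.+-0-abelianGroup (ℤ.+ 2) (ℤ.+ d))

-- The right side is 2 for `i = 0` and `d` for `i = 1`. It is taken over the integers because
-- `d - 2` is negative for `d < 2`.
BranchingBound : ℕ → Fin 2 → ℕ → Set
BranchingBound d i m = ℤ.+ m ℤ.≤ ℤ.+ 2 ℤ.+ (ℤ.+ d ℤ.- ℤ.+ 2) ℤ.* ℤ.+ toℕ i

branching⁺ : ∀ {m d} (i : Fin 2) → (2 < m → i ≡ suc zero) → m ≤ d → BranchingBound d i m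
branching⁺ {m} {d} zero i≡1 m≤d rewrite ℤ.*-zeroʳ (ℤ.+ d ℤ.- ℤ.+ 2) =
  +≤+ (≮⇒≥ λ 2<m → contradiction (i≡1 2<m) λ ())
branching⁺ {m} {d} (suc zero) _ m≤d rewrite ℤ.*-identityʳ (ℤ.+ d ℤ.- ℤ.+ 2) | 2+[d-2]≡d d = +≤+ m≤d

branching⁻ : ∀ {m d} (i : Fin 2) → BranchingBound d i m → 2 < m → i ≡ suc zero
branching⁻ {m} {d} zero m≤ 2<m rewrite ℤ.*-zeroʳ (ℤ.+ d ℤ.- ℤ.+ 2) =
  contradiction (ℤ.drop‿+≤+ m≤) (<⇒≱ 2<m)
branching⁻ (suc zero) _ _ = refl

-- Lifting cycles to the decomposition

module _ {V : FiniteSet} (G : Graph V) where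
  open Decomposition G
  open FiniteSet V using (_≟_)
  open Graph G

  private
    infix 4 _∼ₒ_ _∼ₒ′_
    _∼ₒ_ _∼ₒ′_ : Rel Vertexₒ 0ℓ
    _∼ₒ_  = Graph._∼_ Gₒ
    _∼ₒ′_ = Graph._∼_ Gₒ′

  side : ∀ v w → .(w ≢ v) → Fin (α v)
  side v w w≢v = Classes.class (components (deleteVertex v)) (w , [ w≢v ])

  side-cong : ∀ {v u w} .(u≢v : u ≢ v) .(w≢v : w ≢ v) → Star (Avoiding _∼_ v) u w → side v u u≢v ≡ side v w w≢v
  side-cong {v} u≢v w≢v p = Classes.complete (components (deleteVertex v)) (within u≢v w≢v p)
    where
    within : ∀ {u w} .(u≢v : u ≢ v) .(w≢v : w ≢ v) → Star (Avoiding _∼_ v) u w →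
             Reachable (deleteVertex v) (u , [ u≢v ]) (w , [ w≢v ])
    within _ _ ε = ε
    within u≢v w≢v ((u∼x , _ , x≢v) ◅ p) = u∼x ◅ within x≢v w≢v p

  end-cong : ∀ {v u w} .(u≢v : u ≢ v) .(w≢v : w ≢ v) → Star (Avoiding _∼_ v) u w → end v u u≢v ≡ end v w w≢v
  end-cong {v} u≢v w≢v p with obligatory? v
  ... | yes o = cong (copy v o) (side-cong u≢v w≢v p)
  ... | no  _ = refl

  π-end : ∀ u v .(v≢u : v ≢ u) → π (end u v v≢u) ≡ u
  π-end u v v≢u with obligatory? u
  ... | yes _ = refl
  ... | no  _ = refl

  ∼ₒ⁺ : ∀ {u v} (u∼v : u ∼ v) → end u v (∼⇒≢ (∼-sym u∼v)) ∼ₒ end v u (∼⇒≢ u∼v)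
  -- `π (end u v _)` does not reduce to `u`, so the two ends are generalised to variables whose
  -- projections can be matched.
  ∼ₒ⁺ {u} {v} u∼v = go (π-end u v _) (π-end v u _) refl refl
    where
    go : ∀ {a b} → π a ≡ u → π b ≡ v → a ≡ end u v (∼⇒≢ (∼-sym u∼v)) → b ≡ end v u (∼⇒≢ u∼v) → a ∼ₒ b
    go refl refl a≡ b≡ = u∼v , a≡ , b≡

  ∼ₒ′⁺ : ∀ {u v} (u∼v : u ∼ v) → ¬ CutEdge G u v → end u v (∼⇒≢ (∼-sym u∼v)) ∼ₒ′ end v u (∼⇒≢ u∼v)
  ∼ₒ′⁺ {u} {v} u∼v ¬cut = ∼ₒ⁺ u∼v , subst₂ (λ u v → ¬ CutEdge G u v) (sym (π-end u v _)) (sym (π-end v u _)) ¬cut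

  -- The decomposition splits vertices but never edges: `end` reads both endpoints off the edge of
  -- `G` below.
  ∼ₒ-determined : ∀ {a b c d} → a ∼ₒ b → c ∼ₒ d → π a ≡ π c → π b ≡ π d → a ≡ c
  ∼ₒ-determined (_ , a≡ , _) (_ , c≡ , _) πa≡πc πb≡πd = trans a≡ (trans (ends πa≡πc πb≡πd) (sym c≡))
    where
    ends : ∀ {u v w x} .{p : v ≢ u} .{q : x ≢ w} → u ≡ w → v ≡ x → end u v p ≡ end w x q
    ends refl refl = refl

  Lifted : Rel (Carrier V) 0ℓ → Rel Vertexₒ 0ℓ
  Lifted H a b = a ∼ₒ′ b × H (π a) (π b)

  -- Together with uv, a path from u to v is a cycle, so its edges are not cut
  -- edges, and two consecutive edges at w lead into the same component of G - w.
  module _ {H : Rel (Carrier V) 0ℓ} (H⊆G : ∀ {x y} → H x y → x ∼ y) {u v} (u∼v : u ∼ v) where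

    private
      target : ∀ {q x y} → Star (Avoiding _∼_ q) x y → x ≢ q → y ≢ q
      target ε                  x≢q = x≢q
      target ((_ , _ , z≢q) ◅ p) _  = target p z≢q

      avoid⇒delete : ∀ {x y a b} → Avoiding _∼_ x a b → Graph._∼_ (deleteEdge G x y) a b
      avoid⇒delete (a∼b , a≢x , b≢x) = a∼b , [ a≢x ∘ proj₁ , b≢x ∘ proj₂ ]′

      lift-step : ∀ {x y} → (e : H x y) → Reachable (deleteEdge G x y) x y →
        Lifted H (end x y (∼⇒≢ (∼-sym (H⊆G e)))) (end y x (∼⇒≢ (H⊆G e)))
      lift-step {x} {y} e x⇝y = ∼ₒ′⁺ (H⊆G e) (λ cut → cutEdge⇒bridge G cut x⇝y)
        , subst₂ H (sym (π-end x y _)) (sym (π-end y x _)) e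

      -- Invariant: the path has reached `w` over the edge `w′w`, and for each vertex `q` from `w`
      -- onwards `prefix` leads from `u` to `w′` inside `G - q`. At `v` this identifies the copy
      -- reached with the one at which `vu` ends.
      lift-suffix : ∀ {w′ w} (e : H w′ w) (p : Star H w v) → Unique (nodes p) →
        (∀ {q} → q ∈ nodes p → u ≢ q × Star (Avoiding _∼_ q) u w′) →
        Star (Lifted H) (end w w′ (∼⇒≢ (H⊆G e))) (end v u (∼⇒≢ u∼v))
      lift-suffix e ε _ prefix =
        subst (Star (Lifted H) _) (sym (end-cong _ _ (proj₂ (prefix (here refl))))) ε
      lift-suffix {w′} {w} e (_◅_ {j = q} f p) (w∉ ∷ p!) prefix =
        subst (λ a → Star (Lifted H) a _) (end-cong _ _ around)
          (lift-step f (Star.reverse (Graph.∼-sym (deleteEdge G w q))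
             (Star.map avoid⇒delete around ◅◅ (w′∼w ◅ ε)))
           ◅ lift-suffix f p p! λ z∈ →
               let u≢z , u⇝w′ = prefix (there z∈) in
               u≢z , u⇝w′ ◅◅ ((H⊆G e , target u⇝w′ u≢z , All.lookup w∉ z∈) ◅ ε))
        where
        u≢w = proj₁ (prefix (here refl))
        w≢q = All.lookup w∉ (source∈nodes p)
        -- The other way round the cycle: onward from `q` to `v`, across `vu`, and along the part
        -- already traversed. It puts `q` and `w′` on the same side of `w` and, extended by `w′w`,
        -- is a detour around `wq`.
        around : Star (Avoiding _∼_ w) q w′
        around = Star.map (λ (f , ≢w) → H⊆G f , ≢w) (avoiding p w∉)
          ◅◅ ((∼-sym u∼v , All.lookup w∉ (target∈nodes p) ∘ sym , u≢w) ◅ proj₂ (prefix (here refl)))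
        w′≢q : w′ ≢ q
        w′≢q = let u≢q , u⇝w′ = prefix (there (source∈nodes p)) in target u⇝w′ u≢q
        w′∼w : Graph._∼_ (deleteEdge G w q) w′ w
        w′∼w = H⊆G e , λ { (inj₁ (_ , w≡q)) → w≢q w≡q ; (inj₂ (w′≡q , _)) → w′≢q w′≡q }

    lift : ¬ H u v → Star H u v → Star (Lifted H) (end u v (∼⇒≢ (∼-sym u∼v))) (end v u (∼⇒≢ u∼v))
    lift ¬Huv p with simple _≟_ p
    ... | ε , _ = contradiction refl (∼⇒≢ u∼v)
    ... | _◅_ {j = q} f p , (u∉ ∷ p!) =
      subst (λ a → Star (Lifted H) a _) (end-cong _ _ q⇝v)
        (lift-step f (Star.reverse (Graph.∼-sym (deleteEdge G u q))
           (Star.map avoid⇒delete q⇝v ◅◅ (v∼u ◅ ε)))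
         ◅ lift-suffix f p p! (λ z∈ → All.lookup u∉ z∈ , ε))
      where
      q⇝v : Star (Avoiding _∼_ u) q v
      q⇝v = Star.map (λ (f , ≢u) → H⊆G f , ≢u) (avoiding p u∉)
      v∼u : Graph._∼_ (deleteEdge G u q) v u
      -- If `q` were `v`, the path would be the edge `uv` itself and there would be no cycle; `¬Huv`
      -- excludes this.
      v∼u = ∼-sym u∼v , λ { (inj₁ (v≡u , _)) → ∼⇒≢ u∼v (sym v≡u) ; (inj₂ (refl , _)) → ¬Huv f }

  -- The component of G - v in which a vertex of Gₒ lives; a copy of v counts
  -- as living in the component it was made for.
  label : ∀ v → .(Obligatory v) → Vertexₒ → Fin (α v)
  label v o (original w ¬o) with w ≟ v
  ... | yes refl = ⊥-elim-irr (¬o o)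
  ... | no  w≢v  = side v w w≢v
  label v o (copy w _ i) with w ≟ v
  ... | yes refl = i
  ... | no  w≢v  = side v w w≢v

  label-copy : ∀ v .(o o′ : Obligatory v) i → label v o (copy v o′ i) ≡ i
  label-copy v _ _ i with v ≟ v
  ... | yes refl = refl
  ... | no  v≢v  = contradiction refl v≢v

  label-end : ∀ v .(o : Obligatory v) w .(w≢v : w ≢ v) → label v o (end v w w≢v) ≡ side v w w≢v
  label-end v o w w≢v with obligatory? v
  ... | yes o′ = label-copy v o o′ _
  ... | no  ¬o = ⊥-elim-irr (¬o o)

  label-other : ∀ v .(o : Obligatory v) a (πa≢v : π a ≢ v) → label v o a ≡ side v (π a) πa≢v
  label-other v o (original w _) w≢v with w ≟ v
  ... | yes w≡v = contradiction w≡v w≢v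
  ... | no  _   = refl
  label-other v o (copy w _ _) w≢v with w ≟ v
  ... | yes w≡v = contradiction w≡v w≢v
  ... | no  _   = refl

  -- An edge at `v` ends at the copy made for the side of its other endpoint, and an edge missing
  -- `v` is a step of `G - v`.
  label-∼ₒ : ∀ v .(o : Obligatory v) {a b} → a ∼ₒ b → label v o a ≡ label v o b
  label-∼ₒ v o {a} {b} (e , a≡ , b≡) with π a ≟ v | π b ≟ v
  ... | yes refl | yes πb≡v = contradiction (sym πb≡v) (∼⇒≢ e)
  ... | yes refl | no πb≢v  = trans (cong (label v o) a≡) (trans (label-end v o _ _) (sym (label-other v o b πb≢v)))
  ... | no πa≢v | yes refl  = trans (label-other v o a πa≢v) (sym (trans (cong (label v o) b≡) (label-end v o _ _)))
  ... | no πa≢v | no πb≢v   = trans (label-other v o a πa≢v)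
    (trans (side-cong πa≢v πb≢v ((e , πa≢v , πb≢v) ◅ ε)) (sym (label-other v o b πb≢v)))

  π-injective : ∀ {a b} → Reachable Gₒ′ a b → π a ≡ π b → a ≡ b
  π-injective {original v _}  {original _ _}  _ refl = refl
  π-injective {original v ¬o} {copy _ o _}    _ refl = ⊥-elim-irr (¬o o)
  π-injective {copy v o _}    {original _ ¬o} _ refl = ⊥-elim-irr (¬o o)
  π-injective {copy v o i}    {copy _ o′ j}   p refl = cong (copy v o) (begin
    i                      ≡⟨ label-copy v o o i ⟨
    label v o (copy v o i) ≡⟨ Star.fold (λ a b → label v o a ≡ label v o b)
                                (λ (e , _) → trans (label-∼ₒ v o e)) refl p ⟩
    label v o (copy v _ j) ≡⟨ label-copy v o o j ⟩
    j                      ∎)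
    where open ≡-Reasoning

  -- Components of `Gₒ′` as induced graphs.

  -- The membership proof is stored irrelevantly; decidable equality of component indices recovers
  -- it.
  inComponent : ∀ {k} (a : Carrier Vₒ′[ k ]) → componentOf (value a) ≡ k
  inComponent {k} (a , [ p ]) = recompute (componentOf a Fin.≟ k) p

  nonempty : ∀ k → Carrier Vₒ′[ k ]
  nonempty k = let a , a∈ = Classes.surjective (components Gₒ′) k in a , [ a∈ ]

  connectedₒ′ : ∀ {k} (a b : Carrier Vₒ′[ k ]) → Reachable Gₒ′ (value a) (value b)
  connectedₒ′ a b = Classes.sound (components Gₒ′) {value a} {value b}
    (trans (inComponent a) (sym (inComponent b)))

  componentOf-∼ : ∀ {a b} → a ∼ₒ′ b → componentOf a ≡ componentOf b
  componentOf-∼ {a} {b} a∼b = Classes.complete (components Gₒ′) {a} {b} (a∼b ◅ ε)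

  value-injective : ∀ {k} {a b : Carrier Vₒ′[ k ]} → value a ≡ value b → a ≡ b
  value-injective refl = refl

  module _ {k : Fin K} where

    π∘value-injective : ∀ {a b : Carrier Vₒ′[ k ]} → π (value a) ≡ π (value b) → a ≡ b
    π∘value-injective {a} {b} πa≡πb = value-injective (π-injective (connectedₒ′ a b) πa≡πb)

    restrict : {R : Rel Vertexₒ 0ℓ} → (∀ {a b} → R a b → a ∼ₒ′ b) → ∀ {a b} → Star R (value a) (value b) →
               Star (λ (c d : Carrier Vₒ′[ k ]) → R (value c) (value d)) a b
    restrict {R} R⊆ {a} {b} p = go p (inComponent a) (inComponent b)
      where
      go : ∀ {c d} → Star R c d → (c∈ : componentOf c ≡ k) (d∈ : componentOf d ≡ k) →
           Star (λ (c d : Carrier Vₒ′[ k ]) → R (value c) (value d)) (c , [ c∈ ]) (d , [ d∈ ])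
      go ε _ _ = ε
      go {c} (_◅_ {j = x} r p) c∈ d∈ = _◅_ {j = x , [ x∈ ]} r (go p x∈ d∈)
        where
        x∈ : componentOf x ≡ k
        x∈ = trans (sym (componentOf-∼ (R⊆ r))) c∈

  -- Spanning trees and assignments

  Chosen : (∀ k → Assignment k) → ∀ k → Graph Vₒ′[ k ]
  Chosen s k = chosen Gₒ′[ k ] (Assignment.x (s k)) (Assignment.x-sym (s k))

  module _ (s : ∀ k → Assignment k) where
    private
      module T = Graph (assemble s)

    assemble-⊆ : ∀ {u v} → u T.∼ v → u ∼ v
    assemble-⊆ (inj₁ (u∼v , _)) = u∼v
    assemble-⊆ (inj₂ (_ , _ , _ , ((e , _) , _) , _ , refl , refl)) = e

    assemble⁺ : ∀ {k} {a b : Carrier Vₒ′[ k ]} → Graph._∼_ (Chosen s k) a b → π (value a) T.∼ π (value b)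
    assemble⁺ {k} {a} {b} (a∼b , xab) = inj₂ (k , a , b , a∼b , xab , refl , refl)

    -- `assemble` remembers only edges of `G`. The chosen edge is recovered because `Gₒ` has a
    -- single edge over each edge of `G`, and none over a cut edge survives in `Gₒ′`.
    assemble⁻ : ∀ {k} {a b : Carrier Vₒ′[ k ]} → Graph._∼_ Gₒ′[ k ] a b → π (value a) T.∼ π (value b) →
                Graph._∼_ (Chosen s k) a b
    assemble⁻ (_ , ¬cut) (inj₁ cut) = contradiction cut ¬cut
    assemble⁻ {k} {a} {b} a∼b (inj₂ (l , c , d , c∼d , xcd , πc≡πa , πd≡πb)) =
      a∼b , same c d (trans (sym (inComponent c)) (trans (cong componentOf value-c≡a) (inComponent a)))
                 value-c≡a value-d≡b xcd
      where
      value-c≡a : value c ≡ value a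
      value-c≡a = ∼ₒ-determined (proj₁ c∼d) (proj₁ a∼b) πc≡πa πd≡πb
      value-d≡b : value d ≡ value b
      value-d≡b = ∼ₒ-determined (Graph.∼-sym Gₒ (proj₁ c∼d)) (Graph.∼-sym Gₒ (proj₁ a∼b)) πd≡πb πc≡πa
      same : ∀ {l} (c d : Carrier Vₒ′[ l ]) → l ≡ k → value c ≡ value a → value d ≡ value b →
             Assignment.x (s l) c d ≡ suc zero → Assignment.x (s k) a b ≡ suc zero
      same _ _ refl refl refl xcd = xcd

    module _ (connected : ∀ k → Connected (Chosen s k)) (bridges : ∀ k → Bridges (Chosen s k)) where

      assemble-spansₒ′ : ∀ {a b} → Graph._∼_ Gₒ′ a b → Reachable (assemble s) (π a) (π b)
      assemble-spansₒ′ {a} {b} a∼b = Star.gmap (π ∘ value) assemble⁺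
        (proj₂ (connected (componentOf a)) (a , [ refl ]) (b , [ sym (componentOf-∼ a∼b) ]))

      assemble-spans : ∀ {u v} → u ∼ v → Reachable (assemble s) u v
      assemble-spans {u} {v} u∼v = go (cutEdge? G u v)
        where
        go : Dec (CutEdge G u v) → Reachable (assemble s) u v
        go (yes cut) = inj₁ cut ◅ ε
        go (no ¬cut) = subst₂ (Reachable (assemble s)) (π-end u v _) (π-end v u _)
          (assemble-spansₒ′ (∼ₒ′⁺ u∼v ¬cut))

      -- A cut edge is a bridge of `G` already. A detour around a chosen edge would close to a
      -- cycle, lift to `Gₒ′`, and stay in the component of that edge, where the edge is a bridge.
      assemble-bridges : Bridges (assemble s)
      assemble-bridges {u} {v} (inj₁ cut) p =
        cutEdge⇒bridge G cut (Star.map (λ (e , ≢uv) → assemble-⊆ e , ≢uv) p)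
      assemble-bridges (inj₂ (k , a , b , a∼b@((u∼v , a≡ , b≡) , _) , xab , refl , refl)) p =
        bridges k (a∼b , xab) (Star.map unlift (restrict proj₁
          (subst₂ (Star (Lifted (Graph._∼_ (deleteEdge (assemble s) _ _)))) (sym a≡) (sym b≡)
            (lift (assemble-⊆ ∘ proj₁) u∼v (λ (_ , ≢uv) → ≢uv (inj₁ (refl , refl))) p))))
        where
        unlift : ∀ {c d : Carrier Vₒ′[ k ]} →
                 Lifted (Graph._∼_ (deleteEdge (assemble s) (π (value a)) (π (value b)))) (value c) (value d) →
                 Graph._∼_ (deleteEdge (Chosen s k) a b) c d
        unlift (c∼d , e , ≢uv) = assemble⁻ c∼d e
          , λ { (inj₁ (refl , refl)) → ≢uv (inj₁ (refl , refl)) ; (inj₂ (refl , refl)) → ≢uv (inj₂ (refl , refl)) }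

      assemble-spanningTree : Connected G → IsSpanningTree G (assemble s)
      assemble-spanningTree (v₀ , G-connected) =
        assemble-⊆ , (v₀ , λ u v → G-connected u v Star.>>= assemble-spans)
        , bridges⇒acyclic (assemble s) assemble-bridges

  restriction : Graph V → ∀ k → Assignment k
  restriction T k = record
    { x     = λ a b → indicator (Graph._∼?_ T (π (value a)) (π (value b)))
    ; x-sym = λ a b → indicator-cong _ _ (Graph.∼-sym T) (Graph.∼-sym T)
    ; y     = λ b → indicator (2 <? degree T (π (value b)))
    }

  module _ {T : Graph V} (spanning : IsSpanningTree G T) where
    private
      module T = Graph T
      T⊆G = proj₁ spanning
      T-connected = proj₂ (proj₁ (proj₂ spanning))
      T-bridges = acyclic⇒bridges T (proj₂ (proj₂ spanning))

    -- Were the edge missing from `T`, the walk of `T` between its ends would be a detour around it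
    -- in `G`.
    cutEdge⇒∼ : ∀ {u v} → CutEdge G u v → u T.∼ v
    cutEdge⇒∼ {u} {v} cut with u T.∼? v
    ... | yes u∼v = u∼v
    ... | no  u≁v = contradiction (Star.map (λ e → T⊆G e , λ
          { (inj₁ (refl , refl)) → u≁v e ; (inj₂ (refl , refl)) → u≁v (T.∼-sym e) }) (T-connected u v))
        (cutEdge⇒bridge G cut)

    -- Injectivity of the projection on a component ensures that the image of a detour around `ab`
    -- still avoids the edge below `ab`.
    restriction-bridges : ∀ k → Bridges (Chosen (restriction T) k)
    restriction-bridges k {a} {b} (_ , xab) p = T-bridges (indicator⁻ (_ T.∼? _) xab)
      (Star.gmap (π ∘ value) (λ ((_ , xcd) , ≢ab) → indicator⁻ (_ T.∼? _) xcd , ≢ab ∘ Sum.map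
        (λ (πc , πd) → π∘value-injective πc , π∘value-injective πd)
        (λ (πc , πd) → π∘value-injective πc , π∘value-injective πd)) p)

    -- If the edge below `ab` is not in `T`, it closes the walk of `T` between its ends to a cycle,
    -- whose lift connects `a` to `b` by chosen edges.
    restriction-spans : ∀ k {a b : Carrier Vₒ′[ k ]} → Graph._∼_ Gₒ′ (value a) (value b) →
                        Reachable (Chosen (restriction T) k) a b
    restriction-spans k {a} {b} a∼b@((u∼v , a≡ , b≡) , _) = go (π (value a) T.∼? π (value b))
      where
      go : Dec (π (value a) T.∼ π (value b)) → Reachable (Chosen (restriction T) k) a b
      go (yes t) = (a∼b , indicator⁺ (_ T.∼? _) t) ◅ ε
      go (no ¬t) = Star.map (λ (c∼d , t) → c∼d , indicator⁺ (_ T.∼? _) t) (restrict proj₁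
        (subst₂ (Star (Lifted T._∼_)) (sym a≡) (sym b≡) (lift T⊆G u∼v ¬t (T-connected _ _))))

    restriction-connected : ∀ k → Connected (Chosen (restriction T) k)
    restriction-connected k = nonempty k , λ b c → restrict id (connectedₒ′ b c) Star.>>= restriction-spans k

    restriction-assembleₒ′ : ∀ {a b} → Graph._∼_ Gₒ′ a b → π a T.∼ π b →
                             Graph._∼_ (assemble (restriction T)) (π a) (π b)
    restriction-assembleₒ′ {a} {b} a∼b t = assemble⁺ (restriction T) {componentOf a}
      {a , [ refl ]} {b , [ sym (componentOf-∼ a∼b) ]} (a∼b , indicator⁺ (_ T.∼? _) t)

    restriction-assemble : ∀ {u v} → u T.∼ v → Graph._∼_ (assemble (restriction T)) u v
    restriction-assemble {u} {v} t = go (cutEdge? G u v)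
      where
      go : Dec (CutEdge G u v) → Graph._∼_ (assemble (restriction T)) u v
      go (yes cut) = inj₁ cut
      go (no ¬cut) = subst₂ (Graph._∼_ (assemble (restriction T))) (π-end u v _) (π-end v u _)
        (restriction-assembleₒ′ (∼ₒ′⁺ (T⊆G t) ¬cut) (subst₂ T._∼_ (sym (π-end u v _)) (sym (π-end v u _)) t))

    assemble-restriction : ∀ {u v} → Graph._∼_ (assemble (restriction T)) u v → u T.∼ v
    assemble-restriction (inj₁ cut) = cutEdge⇒∼ cut
    assemble-restriction (inj₂ (_ , _ , _ , _ , xab , refl , refl)) = indicator⁻ (_ T.∼? _) xab

  -- Degrees and branch vertices

  original-unique : ∀ {a b} → ¬ Artificial b → π a ≡ π b → a ≡ b
  original-unique {original _ _}  {original _ _}  _    refl = refl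
  original-unique {copy _ o _}    {original _ ¬o} _    refl = ⊥-elim-irr (¬o o)
  original-unique {a}             {copy _ _ _}    ¬art _    = contradiction tt ¬art

  -- A vertex that is not artificial is the only one over `v`, so every assembled edge at `v` is a
  -- cut edge or comes from a chosen edge at `b`, and never both.
  degree-assemble : ∀ (s : ∀ k → Assignment k) {k} (b : Carrier Vₒ′[ k ]) → ¬ Artificial (value b) →
    ∑ (neighbours Gₒ′[ k ] b) (λ a → toℕ (Assignment.x (s k) a b)) + γ (π (value b)) ≡
    degree (assemble s) (π (value b))
  degree-assemble s {k} b ¬art = begin
    ∑ (neighbours Gₒ′[ k ] b) (λ a → toℕ (x a b)) + γ v
      ≡⟨ cong (_+ γ v) (∑-indicator (λ a → x a b) (neighbours Gₒ′[ k ] b)) ⟩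
    length chosenNeighbours + γ v
      ≡⟨ cong (_+ γ v) (length-map (π ∘ value) chosenNeighbours) ⟨
    length (map (π ∘ value) chosenNeighbours) + γ v
      ≡⟨ length-++ (map (π ∘ value) chosenNeighbours) ⟨
    length (map (π ∘ value) chosenNeighbours ++ cutNeighbours)
      ≡⟨ length-set listed! (Unique.filter⁺ (T._∼?_ v) (FiniteSet.unique V)) listed⇒∼ ∼⇒listed ⟩
    degree (assemble s) v ∎
    where
    open ≡-Reasoning
    open Assignment (s k) using (x; x-sym)
    module T = Graph (assemble s)
    v = π (value b)
    one? : Decidable (λ a → x a b ≡ suc zero)
    one? a = x a b Fin.≟ suc zero
    chosenNeighbours : List (Carrier Vₒ′[ k ])
    chosenNeighbours = filter one? (neighbours Gₒ′[ k ] b)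
    cutNeighbours : List (Carrier V)
    cutNeighbours = filter (cutEdge? G v) (elements V)
    chosen⁻ : ∀ {a} → a ∈ chosenNeighbours → Graph._∼_ (Chosen s k) b a
    chosen⁻ {a} a∈ = let a∈′ , xab = ∈-filter⁻ one? {xs = neighbours Gₒ′[ k ] b} a∈ in
      proj₂ (∈-filter⁻ (Graph._∼?_ Gₒ′[ k ] b) {xs = elements Vₒ′[ k ]} a∈′) , trans (x-sym b a) xab
    chosen⁺ : ∀ {a} → Graph._∼_ (Chosen s k) b a → a ∈ chosenNeighbours
    chosen⁺ {a} (b∼a , xba) = ∈-filter⁺ one?
      (∈-filter⁺ (Graph._∼?_ Gₒ′[ k ] b) (FiniteSet.complete Vₒ′[ k ] a) b∼a) (trans (x-sym a b) xba)
    cut⁻ : ∀ {u} → u ∈ cutNeighbours → CutEdge G v u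
    cut⁻ u∈ = proj₂ (∈-filter⁻ (cutEdge? G v) {xs = elements V} u∈)
    disjoint : ∀ {u} → ¬ (u ∈ map (π ∘ value) chosenNeighbours × u ∈ cutNeighbours)
    disjoint (u∈ˡ , u∈ʳ) =
      ∈-map-elim (λ u → ¬ CutEdge G v u) (λ a∈ → proj₂ (proj₁ (chosen⁻ a∈))) u∈ˡ (cut⁻ u∈ʳ)
    listed! : Unique (map (π ∘ value) chosenNeighbours ++ cutNeighbours)
    listed! = Unique.++⁺
      (Unique.map⁺ (π∘value-injective) (Unique.filter⁺ one?
        (Unique.filter⁺ (Graph._∼?_ Gₒ′[ k ] b) (FiniteSet.unique Vₒ′[ k ]))))
      (Unique.filter⁺ (cutEdge? G v) (FiniteSet.unique V))
      disjoint
    listed⇒∼ : map (π ∘ value) chosenNeighbours ++ cutNeighbours ⊆ neighbours (assemble s) v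
    listed⇒∼ {u} u∈ = ∈-filter⁺ (T._∼?_ v) (FiniteSet.complete V u)
      (go (∈-++⁻ (map (π ∘ value) chosenNeighbours) u∈))
      where
      go : u ∈ map (π ∘ value) chosenNeighbours ⊎ u ∈ cutNeighbours → v T.∼ u
      go (inj₁ u∈ˡ) = ∈-map-elim (v T.∼_) (λ a∈ → assemble⁺ s (chosen⁻ a∈)) u∈ˡ
      go (inj₂ u∈ʳ) = inj₁ (cut⁻ u∈ʳ)
    ∼⇒listed : neighbours (assemble s) v ⊆ map (π ∘ value) chosenNeighbours ++ cutNeighbours
    ∼⇒listed {u} u∈ = go (proj₂ (∈-filter⁻ (T._∼?_ v) {xs = elements V} u∈))
      where
      move : ∀ {l} (c d : Carrier Vₒ′[ l ]) → l ≡ k → value c ≡ value b → Graph._∼_ (Chosen s l) c d →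
             π (value d) ∈ map (π ∘ value) chosenNeighbours
      move c d refl refl c∼d = ∈-map⁺ (π ∘ value) (chosen⁺ c∼d)
      go : v T.∼ u → u ∈ map (π ∘ value) chosenNeighbours ++ cutNeighbours
      go (inj₁ cut) = ∈-++⁺ʳ (map (π ∘ value) chosenNeighbours)
        (∈-filter⁺ (cutEdge? G v) (FiniteSet.complete V u) cut)
      go (inj₂ (l , c , d , c∼d , xcd , πc≡v , refl)) = ∈-++⁺ˡ (move c d
        (trans (sym (inComponent c)) (trans (cong componentOf c≡b) (inComponent b))) c≡b (c∼d , xcd))
        where
        c≡b : value c ≡ value b
        c≡b = original-unique ¬art πc≡v

  module _ {T : Graph V} (spanning : IsSpanningTree G T) where
    private
      module T = Graph T

    -- `w` is the vertex from which the walk first enters `v`. The part before it lies in `G - v`,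
    -- so `w` is a tree neighbour of `v` in the component of `u`.
    firstHit : ∀ {u v} → Reachable T u v → u ≢ v →
               ∃ λ w → T._∼_ v w × w ≢ v × Star (Avoiding _∼_ v) u w
    firstHit ε u≢v = contradiction refl u≢v
    firstHit {u} {v} (_◅_ {j = x} u∼x x⇝v) u≢v with x ≟ v
    ... | yes refl = u , T.∼-sym u∼x , u≢v , ε
    ... | no  x≢v  = let w , v∼w , w≢v , x⇝w = firstHit x⇝v x≢v in
      w , v∼w , w≢v , (proj₁ spanning u∼x , u≢v , x≢v) ◅ x⇝w

    -- Each component of `G - v` contains a tree neighbour of `v`, and different components give
    -- different neighbours.
    α≤degree : ∀ v → α v ≤ degree T v
    α≤degree v = begin
      α v                              ≡⟨ length-tabulate (λ i → i) ⟨
      length (allFin (α v))            ≡⟨ length-map into (allFin (α v)) ⟨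
      length (map into (allFin (α v))) ≤⟨ length-⊆ (Unique.map⁺ into-injective (Unique.allFin⁺ (α v)))
                                            into-neighbour ⟩
      degree T v                       ∎
      where
      open ≤-Reasoning
      hit : ∀ i → ∃ λ w → T._∼_ v w × Σ (w ≢ v) λ w≢v → side v w w≢v ≡ i
      hit i with (u , [ u≢v ]) , refl ← Classes.surjective (components (deleteVertex v)) i =
        let u≢v′ = recompute (¬? (u ≟ v)) u≢v
            w , v∼w , w≢v , u⇝w = firstHit (proj₂ (proj₁ (proj₂ spanning)) u v) u≢v′
        in w , v∼w , w≢v , sym (side-cong u≢v′ w≢v u⇝w)
      into : Fin (α v) → Carrier V
      into i = proj₁ (hit i)
      into-injective : ∀ {i j} → into i ≡ into j → i ≡ j
      into-injective {i} {j} eq = go eq (proj₂ (proj₂ (hit i))) (proj₂ (proj₂ (hit j)))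
        where
        go : ∀ {w z} → w ≡ z → (Σ (w ≢ v) λ w≢v → side v w w≢v ≡ i) →
             (Σ (z ≢ v) λ z≢v → side v z z≢v ≡ j) → i ≡ j
        go refl (_ , w↦i) (_ , w↦j) = trans (sym w↦i) w↦j
      into-neighbour : map into (allFin (α v)) ⊆ neighbours T v
      into-neighbour = ∈-map-elim (_∈ neighbours T v) λ {i} _ →
        ∈-filter⁺ (T._∼?_ v) (FiniteSet.complete V (into i)) (proj₁ (proj₂ (hit i)))

  originals : ∀ k → List (Carrier Vₒ′[ k ])
  originals k = filter (λ b → ¬? (artificial? (value b))) (elements Vₒ′[ k ])

  ∈-originals⁻ : ∀ {k} {b : Carrier Vₒ′[ k ]} → b ∈ originals k → ¬ Artificial (value b)
  ∈-originals⁻ {k} b∈ = proj₂ (∈-filter⁻ (λ b → ¬? (artificial? (value b))) {xs = elements Vₒ′[ k ]} b∈)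

  branches : Graph V → ∀ k → List (Carrier Vₒ′[ k ])
  branches T k = filter (λ b → 2 <? degree T (π (value b))) (originals k)

  -- Obligatory vertices are branches of every spanning tree; each other vertex appears as an
  -- original in exactly one component. So the listed blocks partition the branch vertices.
  branchVertices-split : ∀ {T} → IsSpanningTree G T →
    branchVertices T ≡ ∣Lₒ∣ + sum (tabulate (λ k → length (branches T k)))
  branchVertices-split {T} spanning = begin
    branchVertices T
      ≡⟨ length-set (Unique.filter⁺ branch? (FiniteSet.unique V)) listed! branch⇒listed listed⇒branch ⟩
    length (obligatories ++ concat (map block (allFin K)))
      ≡⟨ length-++ obligatories ⟩
    ∣Lₒ∣ + length (concat (map block (allFin K)))
      ≡⟨ cong (∣Lₒ∣ +_) (length-concat (map block (allFin K))) ⟩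
    ∣Lₒ∣ + sum (map length (map block (allFin K)))
      ≡⟨ cong (λ ms → ∣Lₒ∣ + sum ms) lengths ⟩
    ∣Lₒ∣ + sum (tabulate (λ k → length (branches T k))) ∎
    where
    open ≡-Reasoning
    branch? : Decidable (λ v → 2 < degree T v)
    branch? v = 2 <? degree T v
    branchₒ? : ∀ {k} → Decidable (λ (b : Carrier Vₒ′[ k ]) → 2 < degree T (π (value b)))
    branchₒ? b = 2 <? degree T (π (value b))
    obligatories : List (Carrier V)
    obligatories = filter obligatory? (elements V)
    block : Fin K → List (Carrier V)
    block k = map (π ∘ value) (branches T k)
    lengths : map length (map block (allFin K)) ≡ tabulate (λ k → length (branches T k))
    lengths = begin
      map length (map block (allFin K))      ≡⟨ cong (map length) (map-tabulate id block) ⟩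
      map length (tabulate block)            ≡⟨ map-tabulate block length ⟩
      tabulate (length ∘ block)              ≡⟨ tabulate-cong (λ k → length-map (π ∘ value) (branches T k)) ⟩
      tabulate (λ k → length (branches T k)) ∎
    branches⁻ : ∀ {k v} → v ∈ block k → ∃ λ (b : Carrier Vₒ′[ k ]) →
                π (value b) ≡ v × ¬ Artificial (value b) × 2 < degree T v
    branches⁻ {k} = ∈-map-elim
      (λ v → ∃ λ (b : Carrier Vₒ′[ k ]) → π (value b) ≡ v × ¬ Artificial (value b) × 2 < degree T v)
      λ {b} b∈ → let b∈′ , 2<d = ∈-filter⁻ branchₒ? {xs = originals k} b∈ in b , refl , ∈-originals⁻ b∈′ , 2<d
    blocks⁻ : ∀ {v} → v ∈ concat (map block (allFin K)) → ∃ λ b → π b ≡ v × ¬ Artificial b × 2 < degree T v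
    blocks⁻ v∈ =
      let _ , v∈′ , vs∈ = ∈-concat⁻′ (map block (allFin K)) v∈
      in ∈-map-elim (λ vs → ∀ {v} → v ∈ vs → ∃ λ b → π b ≡ v × ¬ Artificial b × 2 < degree T v)
           (λ {k} _ v∈ → let b , p = branches⁻ v∈ in value b , p) vs∈ v∈′
    ∈-blocks : ∀ a → ¬ Artificial a → 2 < degree T (π a) → π a ∈ concat (map block (allFin K))
    ∈-blocks a ¬art 2<d = ∈-concat⁺′
      (∈-map⁺ (π ∘ value) {x = a , [ refl ]} (∈-filter⁺ branchₒ?
        (∈-filter⁺ (λ b → ¬? (artificial? (value b))) 
          (FiniteSet.complete Vₒ′[ componentOf a ] (a , [ refl ])) ¬art) 2<d))
      (∈-map⁺ block (∈-allFin (componentOf a)))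
    blocks-disjoint : ∀ {k l v} → k ≢ l → ¬ (v ∈ block k × v ∈ block l)
    blocks-disjoint k≢l (v∈k , v∈l) =
      let a , πa≡v , _    , _ = branches⁻ v∈k
          b , πb≡v , ¬art , _ = branches⁻ v∈l
      in k≢l (trans (sym (inComponent a)) (trans
           (cong componentOf (original-unique ¬art (trans πa≡v (sym πb≡v)))) (inComponent b)))
    original-¬obligatory : ∀ a → ¬ Artificial a → ¬ Obligatory (π a)
    original-¬obligatory (original _ ¬o) _    o = ⊥-elim-irr (¬o o)
    original-¬obligatory (copy _ _ _)    ¬art _ = ¬art tt
    listed! : Unique (obligatories ++ concat (map block (allFin K)))
    listed! = Unique.++⁺ (Unique.filter⁺ obligatory? (FiniteSet.unique V))
      (Unique.concat⁺
        (All.map⁺ (All.universal (λ k → Unique.map⁺ (π∘value-injective) (Unique.filter⁺ branchₒ?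
          (Unique.filter⁺ (λ b → ¬? (artificial? (value b))) (FiniteSet.unique Vₒ′[ k ])))) (allFin K)))
        (AllPairs.map⁺ (AllPairs.map (λ k≢l {_} → blocks-disjoint k≢l) (Unique.allFin⁺ K))))
      disjoint
      where
      disjoint : ∀ {v} → ¬ (v ∈ obligatories × v ∈ concat (map block (allFin K)))
      disjoint (v∈ˡ , v∈ʳ) =
        let b , πb≡v , ¬art , _ = blocks⁻ v∈ʳ
        in original-¬obligatory b ¬art
             (subst Obligatory (sym πb≡v) (proj₂ (∈-filter⁻ obligatory? {xs = elements V} v∈ˡ)))
    listed⇒branch : obligatories ++ concat (map block (allFin K)) ⊆ filter branch? (elements V)
    listed⇒branch {v} v∈ = ∈-filter⁺ branch? (FiniteSet.complete V v) (go (∈-++⁻ obligatories v∈))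
      where
      go : v ∈ obligatories ⊎ v ∈ concat (map block (allFin K)) → 2 < degree T v
      go (inj₁ v∈ˡ) = ≤-trans (proj₂ (∈-filter⁻ obligatory? {xs = elements V} v∈ˡ)) (α≤degree {T} spanning v)
      go (inj₂ v∈ʳ) = let _ , _ , _ , 2<d = blocks⁻ v∈ʳ in 2<d
    branch⇒listed : filter branch? (elements V) ⊆ obligatories ++ concat (map block (allFin K))
    branch⇒listed {v} v∈ = go (obligatory? v)
      where
      2<d = proj₂ (∈-filter⁻ branch? {xs = elements V} v∈)
      go : Dec (Obligatory v) → v ∈ obligatories ++ concat (map block (allFin K))
      go (yes o) = ∈-++⁺ˡ (∈-filter⁺ obligatory? (FiniteSet.complete V v) o)
      go (no ¬o) = ∈-++⁺ʳ obligatories (∈-blocks (original v ¬o) id 2<d)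

  -- Feasible assignments against spanning trees.

  feasible⇒bridges : ∀ {k} {s : ∀ k → Assignment k} → FeasibleAssignment (s k) → Bridges (Chosen s k)
  feasible⇒bridges {k} {s} f = subtour⇒bridges Gₒ′[ k ] (Assignment.x (s k)) (Assignment.x-sym (s k))
    (FeasibleAssignment.subtour f)

  feasible⇒connected : ∀ {k} {s : ∀ k → Assignment k} → FeasibleAssignment (s k) → Connected (Chosen s k)
  feasible⇒connected {k} {s} f = edgeCount⇒connected Gₒ′[ k ] (Assignment.x (s k)) (Assignment.x-sym (s k))
    (nonempty k) (feasible⇒bridges {k} {s} f) (FeasibleAssignment.edgeCount f)

  feasible⇒spanningTree : Connected G → {s : ∀ k → Assignment k} → (∀ k → FeasibleAssignment (s k)) →
                          IsSpanningTree G (assemble s)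
  feasible⇒spanningTree connected {s} f = assemble-spanningTree s
    (λ k → feasible⇒connected {k} {s} (f k)) (λ k → feasible⇒bridges {k} {s} (f k)) connected

  -- Only an inequality: the constraint forces `y = 1` where the degree exceeds 2 but does not force
  -- `y = 0` elsewhere.
  branches≤branchSum : (s : ∀ k → Assignment k) → ∀ {k} → FeasibleAssignment (s k) →
                       length (branches (assemble s) k) ≤ branchSum (s k)
  branches≤branchSum s {k} f = begin
    length (branches (assemble s) k)
      ≤⟨ length-filter-mono (λ b → 2 <? degree (assemble s) (π (value b))) (λ b → y b Fin.≟ suc zero)
           (All.tabulate λ {b} b∈ → branching⁻ {d = degree G (π (value b))} (y b)
             (subst (BranchingBound (degree G (π (value b))) (y b))
               (degree-assemble s b (∈-originals⁻ b∈)) (FeasibleAssignment.branching f b (∈-originals⁻ b∈)))) ⟩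
    length (filter (λ b → y b Fin.≟ suc zero) (originals k))
      ≡⟨ ∑-indicator y (originals k) ⟨
    branchSum (s k) ∎
    where
    open ≤-Reasoning
    open Assignment (s k) using (y)

  branchVertices-assemble-≤ : Connected G → (s : ∀ k → Assignment k) → (∀ k → FeasibleAssignment (s k)) →
                              branchVertices (assemble s) ≤ ∣Lₒ∣ + sum (tabulate (λ k → branchSum (s k)))
  branchVertices-assemble-≤ connected s f = ≤-trans
    (≤-reflexive (branchVertices-split {assemble s} (feasible⇒spanningTree connected {s} f)))
    (+-monoʳ-≤ ∣Lₒ∣ (sum-tabulate-mono λ k → branches≤branchSum s (f k)))

  module _ {T : Graph V} (spanning : IsSpanningTree G T) where

    restriction-feasible : ∀ k → FeasibleAssignment (restriction T k)
    restriction-feasible k = record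
      { edgeCount = tree⇒edgeCount Gₒ′[ k ] x x-sym
                      (restriction-connected {T} spanning k) (restriction-bridges {T} spanning k)
      ; subtour   = bridges⇒subtour Gₒ′[ k ] x x-sym (restriction-bridges {T} spanning k)
      ; branching = λ b ¬art → subst (BranchingBound (degree G (π (value b))) (y b))
          -- The left side of the constraint is a degree in the reassembled graph, which has the
          -- same edges as `T`.
          (sym (trans (degree-assemble (restriction T) b ¬art) degree≡))
          (branching⁺ {d = degree G (π (value b))} (y b) (indicator⁺ (2 <? degree T (π (value b))))
            (degree-mono T G (proj₁ spanning)))
      }
      where
      open Assignment (restriction T k)
      degree≡ : ∀ {v} → degree (assemble (restriction T)) v ≡ degree T v
      degree≡ = ≤-antisym
        (degree-mono (assemble (restriction T)) T (assemble-restriction {T} spanning))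
        (degree-mono T (assemble (restriction T)) (restriction-assemble {T} spanning))

    branchSum-restriction : ∀ k → branchSum (restriction T k) ≡ length (branches T k)
    branchSum-restriction k = trans (∑-indicator (Assignment.y (restriction T k)) (originals k))
      (cong length (filter-≐ (λ b → Assignment.y (restriction T k) b Fin.≟ suc zero)
        (λ b → 2 <? degree T (π (value b)))
        (indicator⁻ _ , indicator⁺ _) (originals k)))

    branchVertices-restriction : branchVertices T ≡ ∣Lₒ∣ + sum (tabulate (λ k → branchSum (restriction T k)))
    branchVertices-restriction = trans (branchVertices-split {T} spanning)
      (cong (λ ns → ∣Lₒ∣ + sum ns) (tabulate-cong (sym ∘ branchSum-restriction)))

-- Existence of optimal assignments

module _ {V : FiniteSet} (G : Graph V) (k : Fin (Decomposition.K G)) where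
  open Decomposition G
  open Assignment
  open FeasibleAssignment

  private
    W : FiniteSet
    W = Vₒ′[ k ]
    X : Set
    X = Carrier W → Carrier W → Fin 2

  _≈_ : Rel (Assignment k) 0ℓ
  s ≈ t = (∀ a b → x s a b ≡ x t a b) × (∀ b → y s b ≡ y t b)

  ∑-cong : ∀ {A : Set} (as : List A) {f g : A → Fin 2} → (∀ a → f a ≡ g a) → ∑ as (toℕ ∘ f) ≡ ∑ as (toℕ ∘ g)
  ∑-cong as f≡g = cong sum (map-cong (cong toℕ ∘ f≡g) as)

  feasible-resp-≈ : ∀ {s t} → s ≈ t → FeasibleAssignment s → FeasibleAssignment t
  feasible-resp-≈ {s} {t} (x≡ , y≡) f = record
    { edgeCount = trans (sym (∑-cong (edges Gₒ′[ k ]) λ (a , b) → x≡ a b)) (edgeCount f)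
    ; subtour   = λ S S≢∅ → ≤-trans (≤-reflexive (sym (∑-cong (edgesWithin S) λ (a , b) → x≡ a b))) (subtour f S S≢∅)
    ; branching = λ b ¬art → subst₂ (λ n i → BranchingBound (degree G (π (value b))) i (n + γ (π (value b))))
        (∑-cong (neighbours Gₒ′[ k ] b) λ a → x≡ a b) (y≡ b) (branching f b ¬art)
    }

  branchSum-cong : ∀ {s t} → s ≈ t → branchSum s ≡ branchSum t
  branchSum-cong (_ , y≡) = ∑-cong (filter (λ b → ¬? (artificial? (value b))) (elements W)) y≡

  module _ (s : Assignment k) where

    Subtour : (Carrier W → Bool) → Set
    Subtour S = (∃ λ a → T (S a)) → ∑ (edgesWithin S) (λ (a , b) → toℕ (x s a b)) ≤ count W (T? ∘ S) ∸ 1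

    subtour-resp-≗ : ∀ {S S′} → (∀ a → S a ≡ S′ a) → Subtour S → Subtour S′
    subtour-resp-≗ {S} {S′} S≗S′ sub (a , S′a) = subst₂ (λ es n → ∑ es (λ (a , b) → toℕ (x s a b)) ≤ n ∸ 1)
      (filter-≐ (λ (a , b) → T? (S a) ×-dec T? (S b)) (λ (a , b) → T? (S′ a) ×-dec T? (S′ b))
        ((λ (Sa , Sb) → ⇒ Sa , ⇒ Sb) , λ (Sa , Sb) → ⇐ Sa , ⇐ Sb) (edges Gₒ′[ k ]))
      (cong length (filter-≐ (T? ∘ S) (T? ∘ S′) (⇒ , ⇐) (elements W)))
      (sub (a , ⇐ S′a))
      where
      ⇒ : ∀ {a} → T (S a) → T (S′ a)
      ⇒ = subst T (S≗S′ _)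
      ⇐ : ∀ {a} → T (S′ a) → T (S a)
      ⇐ = subst T (sym (S≗S′ _))

    private
      subsets : List (Carrier W → Bool)
      subsets = functions (FiniteSet._≟_ W) false (true ∷ false ∷ []) (elements W)

      -- The constraint depends only on the values of `S`, so checking one representative of each
      -- subset decides it for all `S`.
      subtour? : Dec (∀ S → Subtour S)
      subtour? = map′
        (λ all S → let S′ , S′∈ , S′≗S = functions-complete (FiniteSet._≟_ W) false (true ∷ false ∷ []) _≡_ S
                         (λ a → S a , bool∈ (S a) , refl) (elements W)
                   in subtour-resp-≗ (λ a → S′≗S (FiniteSet.complete W a)) (All.lookup all S′∈))
        (λ all → All.universal all subsets)
        (All.all? (λ S → ∃? W (T? ∘ S) →-dec (_ ≤? _)) subsets)
        where
        bool∈ : ∀ b → b ∈ true ∷ false ∷ []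
        bool∈ true  = here refl
        bool∈ false = there (here refl)

      Branching : Carrier W → Set
      Branching b = ¬ Artificial (value b) → BranchingBound (degree G (π (value b))) (y s b)
        (∑ (neighbours Gₒ′[ k ] b) (λ a → toℕ (x s a b)) + γ (π (value b)))

      branching? : Dec (∀ b → Branching b)
      branching? = map′ (λ all b → All.lookup all (FiniteSet.complete W b)) (λ all → All.universal all (elements W))
        (All.all? (λ b → ¬? (artificial? (value b)) →-dec (_ ℤ.≤? _)) (elements W))

    feasible? : Dec (FeasibleAssignment s)
    feasible? = map′ (λ (e , t , b) → record { edgeCount = e ; subtour = t ; branching = b })
      (λ f → edgeCount f , subtour f , branching f) ((_ ≟ℕ _) ×-dec (subtour? ×-dec branching?))

  private
    _⊓_ : Fin 2 → Fin 2 → Fin 2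
    zero     ⊓ _ = zero
    suc zero ⊓ j = j

    ⊓-comm : ∀ i j → i ⊓ j ≡ j ⊓ i
    ⊓-comm zero       zero       = refl
    ⊓-comm zero       (suc zero) = refl
    ⊓-comm (suc zero) zero       = refl
    ⊓-comm (suc zero) (suc zero) = refl

    ⊓-idem : ∀ i → i ⊓ i ≡ i
    ⊓-idem zero       = refl
    ⊓-idem (suc zero) = refl

    -- Every pair of functions yields an assignment, and a symmetric x is left unchanged.
    symmetrised : X → (Carrier W → Fin 2) → Assignment k
    symmetrised x y = record { x = λ a b → x a b ⊓ x b a ; x-sym = λ a b → ⊓-comm (x a b) (x b a) ; y = y }

    ys : List (Carrier W → Fin 2)
    ys = functions (FiniteSet._≟_ W) zero (allFin 2) (elements W)

    ys-complete : (g : Carrier W → Fin 2) → ∃ λ f → f ∈ ys × (∀ b → f b ≡ g b)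
    ys-complete g =
      let f , f∈ , f≡g = functions-complete (FiniteSet._≟_ W) zero (allFin 2) _≡_ g
                          (λ b → g b , ∈-allFin (g b) , refl) (elements W)
      in f , f∈ , λ b → f≡g (FiniteSet.complete W b)

    xs : List X
    xs = functions (FiniteSet._≟_ W) (λ _ → zero) ys (elements W)

    xs-complete : (g : X) → ∃ λ f → f ∈ xs × (∀ a b → f a b ≡ g a b)
    xs-complete g =
      let f , f∈ , f≡g = functions-complete (FiniteSet._≟_ W) (λ _ → zero) ys (λ f g → ∀ b → f b ≡ g b) g
                          (ys-complete ∘ g) (elements W)
      in f , f∈ , λ a → f≡g (FiniteSet.complete W a)

    assignments : List (Assignment k)
    assignments = cartesianProductWith symmetrised xs ys

    assignments-complete : ∀ s → ∃ λ t → t ∈ assignments × s ≈ t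
    assignments-complete s =
      let f , f∈ , f≡x = xs-complete (x s)
          g , g∈ , g≡y = ys-complete (y s)
      in symmetrised f g , ∈-cartesianProductWith⁺ symmetrised f∈ g∈
       , (λ a b → sym (trans (cong₂ _⊓_ (f≡x a b) (trans (f≡x b a) (x-sym s b a))) (⊓-idem (x s a b))))
       , (λ b → sym (g≡y b))

  optimal-exists : ∃ FeasibleAssignment → ∃ (IsOptimal (componentProgram k))
  optimal-exists (s , s-feasible) =
    -- The given feasible `s` is the starting value of the minimum, so the result is feasible
    -- whatever the candidate list contains.
    argmin branchSum s candidates ,
    argmin-all branchSum s-feasible (All.tabulate λ t∈ → proj₂ (∈-filter⁻ feasible? {xs = assignments} t∈)) ,
    λ s′ s′-feasible → let t , t∈ , s′≈t = assignments-complete s′ in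
      ≤-trans (All.lookup (f[argmin]≤f[xs] {f = branchSum} s candidates)
                (∈-filter⁺ feasible? t∈ (feasible-resp-≈ s′≈t s′-feasible)))
              (≤-reflexive (sym (branchSum-cong {s′} {t} s′≈t)))
    where
    candidates : List (Assignment k)
    candidates = filter feasible? assignments

-- Comparison of the optimum on `G` with the optima of the components.

proposition1 : {V : FiniteSet} (G : Graph V) → Connected G →
    let open Decomposition G in
    (∀ k → ∃ λ s → IsOptimal (componentProgram k) s)
    × (∀ (s : ∀ k → Assignment k) →
    (∀ k → IsOptimal (componentProgram k) (s k)) →
    IsOptimal (minimumBranchVertices G) (assemble s))
    × (∀ (z : ℕ) (zₖ : Fin K → ℕ) →
    IsOptimalValue (minimumBranchVertices G) z →
    (∀ k → IsOptimalValue (componentProgram k) (zₖ k)) →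
    z ≡ ∣Lₒ∣ + sum (tabulate zₖ))
proposition1 {V} G connected = optima , assembled-optimal , value-formula
  where
  open Decomposition G

  optima : ∀ k → ∃ λ s → IsOptimal (componentProgram k) s
  -- The restriction of an arbitrary spanning tree supplies the feasible assignment that the search
  -- for an optimum starts from.
  optima k = let T , spanning = spanningTree G connected in
    optimal-exists G k (restriction G T k , restriction-feasible G {T} spanning k)

  -- The branch count of `T` is `∣Lₒ∣` plus the objectives of its restrictions, and each restriction
  -- competes with the optimum of its component.
  lower-bound : (s : ∀ k → Assignment k) → (∀ k → IsOptimal (componentProgram k) (s k)) →
                ∀ {T} → IsSpanningTree G T → ∣Lₒ∣ + sum (tabulate (λ k → branchSum (s k))) ≤ branchVertices T
  lower-bound s optimal {T} spanning = ≤-trans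
    (+-monoʳ-≤ ∣Lₒ∣ (sum-tabulate-mono λ k →
      proj₂ (optimal k) (restriction G T k) (restriction-feasible G {T} spanning k)))
    (≤-reflexive (sym (branchVertices-restriction G {T} spanning)))

  assembled-optimal : ∀ (s : ∀ k → Assignment k) → (∀ k → IsOptimal (componentProgram k) (s k)) →
                      IsOptimal (minimumBranchVertices G) (assemble s)
  assembled-optimal s optimal = feasible⇒spanningTree G connected {s} (proj₁ ∘ optimal) ,
    λ T spanning → ≤-trans (branchVertices-assemble-≤ G connected s (proj₁ ∘ optimal))
                           (lower-bound s optimal {T} spanning)

  value-formula : ∀ (z : ℕ) (zₖ : Fin K → ℕ) → IsOptimalValue (minimumBranchVertices G) z →
                  (∀ k → IsOptimalValue (componentProgram k) (zₖ k)) → z ≡ ∣Lₒ∣ + sum (tabulate zₖ)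
  value-formula z zₖ (T , (spanning , T-minimal) , T≡z) optimal = begin
    z                                                   ≡⟨ T≡z ⟨
    -- Upper bound: `T` is no worse than the tree assembled from the optimal assignments, whose
    -- surplus values of `y` can only raise the right side.
    branchVertices T                                    ≡⟨ ≤-antisym
      (≤-trans (T-minimal (assemble s) (feasible⇒spanningTree G connected {s} (proj₁ ∘ s-optimal)))
               (branchVertices-assemble-≤ G connected s (proj₁ ∘ s-optimal)))
      (lower-bound s s-optimal {T} spanning) ⟩
    ∣Lₒ∣ + sum (tabulate (λ k → branchSum (s k)))       ≡⟨ cong (λ ns → ∣Lₒ∣ + sum ns)
                                                             (tabulate-cong (λ k → proj₂ (proj₂ (optimal k)))) ⟩
    ∣Lₒ∣ + sum (tabulate zₖ)                            ∎
    where
    open ≡-Reasoning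
    s : ∀ k → Assignment k
    s k = proj₁ (optimal k)
    s-optimal : ∀ k → IsOptimal (componentProgram k) (s k)
    s-optimal k = proj₁ (proj₂ (optimal k))
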